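{- Let $\ell$ be an odd prime number and $t\in\mathbb{Z}_{\ge2}$. Then $$\mathrm{Prob}_\ell(X_t;\mu=0,\lambda=1)=\begin{cases}1-\dfrac{\ell^{t-1}+(-1)^{\frac{t(\ell-1)}{4}}(\ell-1)\ell^{\frac t2-1}-1}{\ell^t-1}&\text{if }t\text{ is even},\\[2mm]1-\dfrac{\ell^{t-1}-1}{\ell^t-1}&\text{if }t\text{ is odd}.\end{cases}$$
   Context: For $b\in\mathbb{Z}_\ell$ put $\binom{b}{n}=\frac{b(b-1)\cdots(b-n+1)}{n!}\in\mathbb{Z}_\ell$ and $(1+T)^b=\sum_{n\ge0}\binom{b}{n}T^n\in\mathbb{Z}_\ell[[T]]$. The bouquet $X_t$ is the multigraph with one vertex and $t$ undirected loops; a vector $\alpha=(\alpha_1,\dots,\alpha_t)\in\mathbb{Z}_\ell^t$ assigns the voltage $\alpha_j$ to the $j$-th loop. It is admissible if $\alpha\in\mathbb{Z}_\ell^t\setminus(\ell\mathbb{Z}_\ell)^t$. The characteristic series is $$f(T)=f_{X_t,\alpha}(T)=\sum_{j=1}^t\big(2-(1+T)^{\alpha_j}-(1+T)^{ -\alpha_j}\big)\in\mathbb{Z}_\ell[[T]].$$ For admissible $\alpha$ it is nonzero, and it has zero constant term. By Weierstrass preparation write $f(T)=\ell^{\mu}g(T)u(T)$ with $\mu\in\mathbb{Z}_{\ge0}$, $g$ a distinguished polynomial (monic, all non-leading coefficients divisible by $\ell$) and $u\in\mathbb{Z}_\ell[[T]]^\times$. Then $\mu_\ell(X_t,\alpha):=\mu$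 and $\lambda_\ell(X_t,\alpha):=\deg g-1$ (note the shift by $-1$). Let $\tau$ be the Haar measure on $\mathbb{Z}_\ell^t$ normalized by $\tau(\mathbb{Z}_\ell^t)=1$, so $\tau(\mathbb{Z}_\ell^t\setminus(\ell\mathbb{Z}_\ell)^t)=1-\ell^{ -t}$. Define $$\mathrm{Prob}_\ell(X_t;\mu=\mu_0,\lambda=\lambda_0)=(1-\ell^{ -t})^{ -1}\,\tau\big(\{\alpha\in\mathbb{Z}_\ell^t\setminus(\ell\mathbb{Z}_\ell)^t:\mu_\ell(X_t,\alpha)=\mu_0,\ \lambda_\ell(X_t,\alpha)=\lambda_0\}\big).$$ -}

module Defs where

open import Algebra.Bundles using (CommutativeRing; module Semiring)
import Algebra.Definitions
open import Data.Empty using (⊥-elim)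
open import Data.Fin.Base using (toℕ)
open import Data.Integer.Base using (ℤ; +_; -[1+_]; 0ℤ; 1ℤ; -1ℤ)
import Data.Integer.Base as ℤ
import Data.Integer.Properties as ℤ
open import Data.Integer.Divisibility.Signed
  using (_∣_; divides; ∣ᵤ⇒∣; ∣⇒∣ᵤ; ∣-trans; ∣m∣n⇒∣m+n; ∣m∣n⇒∣m-n; ∣m⇒∣-m; ∣m⇒∣m*n; ∣n⇒∣m*n)
open import Data.Integer.Tactic.RingSolver using (solve-∀)
open import Data.Maybe.Base using (Maybe; maybe)
open import Data.Maybe.Relation.Unary.Any using (Any)
open import Data.Nat.Base using (ℕ; zero; suc; NonZero; _^_; _∸_; _!; s≤s; z≤n)
import Data.Nat.Base as ℕ
import Data.Nat.Properties as ℕ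
import Data.Nat.Divisibility as ℕ
open import Data.Nat.Primality using (Prime; prime⇒nonZero; prime⇒nonTrivial; euclidsLemma)
open import Data.Product.Base using (∃-syntax; _×_; _,_)
open import Data.Rational.Base using (ℚ; 0ℚ; 1ℚ; _/_)
import Data.Rational.Base as ℚ
open import Data.Sum.Base using (inj₁; inj₂)
open import Data.Vec.Functional using (Vector)
open import Level using (0ℓ)
open import Relation.Binary.PropositionalEquality
  using (_≡_; refl; sym; trans; cong; cong₂; subst; module ≡-Reasoning)
open import Relation.Nullary.Decidable using (yes; no)
open import Relation.Nullary.Negation using (¬_)
open import Relation.Unary using (Pred; ∁)

import Algebra.Definitions.RawMonoid as RawMonoidDefs
import Algebra.Definitions.RawSemiring as RawSemiringDefs

fallℤ : ℤ → ℕ → ℤ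
fallℤ x zero    = 1ℤ
fallℤ x (suc n) = fallℤ x n ℤ.* (x ℤ.- + n)

private
  fall-shift : ∀ x n → fallℤ (1ℤ ℤ.+ x) (suc n) ≡ (1ℤ ℤ.+ x) ℤ.* fallℤ x n
  fall-shift x zero    = lem x
    where
    lem : ∀ x → 1ℤ ℤ.* ((1ℤ ℤ.+ x) ℤ.- 0ℤ) ≡ (1ℤ ℤ.+ x) ℤ.* 1ℤ
    lem = solve-∀
  fall-shift x (suc n) = trans
    (cong (ℤ._* ((1ℤ ℤ.+ x) ℤ.- + suc n)) (fall-shift x n))
    (lem x (fallℤ x n) (+ n))
    where
    lem : ∀ x f m → ((1ℤ ℤ.+ x) ℤ.* f) ℤ.* ((1ℤ ℤ.+ x) ℤ.- (1ℤ ℤ.+ m))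
                  ≡ (1ℤ ℤ.+ x) ℤ.* (f ℤ.* (x ℤ.- m))
    lem = solve-∀

  fall-pascal : ∀ x n → fallℤ (1ℤ ℤ.+ x) (suc n)
                      ≡ fallℤ x (suc n) ℤ.+ + suc n ℤ.* fallℤ x n
  fall-pascal x n = trans (fall-shift x n) (lem x (fallℤ x n) (+ n))
    where
    lem : ∀ x f m → (1ℤ ℤ.+ x) ℤ.* f ≡ f ℤ.* (x ℤ.- m) ℤ.+ (1ℤ ℤ.+ m) ℤ.* f
    lem = solve-∀

!∣fall : ∀ n x → + (n !) ∣ fallℤ x n
!∣fall zero    x = divides 1ℤ refl
!∣fall (suc n) x = go x
  where
  N! = + (suc n !)

  inner : ∀ x → N! ∣ + suc n ℤ.* fallℤ x n
  inner x with divides q eq ← !∣fall n x = divides q (begin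
    + suc n ℤ.* fallℤ x n         ≡⟨ cong (+ suc n ℤ.*_) eq ⟩
    + suc n ℤ.* (q ℤ.* + (n !))   ≡⟨ lem (+ suc n) q (+ (n !)) ⟩
    q ℤ.* (+ suc n ℤ.* + (n !))   ≡⟨ cong (q ℤ.*_) (ℤ.pos-* (suc n) (n !)) ⟨
    q ℤ.* N!                      ∎)
    where
    open ≡-Reasoning
    lem : ∀ a b c → a ℤ.* (b ℤ.* c) ≡ b ℤ.* (a ℤ.* c)
    lem = solve-∀

  up : ∀ x → N! ∣ fallℤ x (suc n) → N! ∣ fallℤ (1ℤ ℤ.+ x) (suc n)
  up x p = subst (N! ∣_) (sym (fall-pascal x n)) (∣m∣n⇒∣m+n p (inner x))

  down : ∀ x → N! ∣ fallℤ (1ℤ ℤ.+ x) (suc n) → N! ∣ fallℤ x (suc n)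
  down x p = subst (N! ∣_)
    (trans (cong (ℤ._- (+ suc n ℤ.* fallℤ x n)) (fall-pascal x n))
           (lem (fallℤ x (suc n)) (+ suc n ℤ.* fallℤ x n)))
    (∣m∣n⇒∣m-n p (inner x))
    where
    lem : ∀ a b → (a ℤ.+ b) ℤ.- b ≡ a
    lem = solve-∀

  go : ∀ x → N! ∣ fallℤ x (suc n)
  go (+ zero)        = divides 0ℤ (fall-shift -1ℤ n)
  go (+ suc m)       = up (+ m) (go (+ m))
  go -[1+ zero ]     = down -1ℤ (go 0ℤ)
  go -[1+ suc m ]    = down -[1+ suc m ] (go -[1+ m ])

module PowerSeries {c r} (R : CommutativeRing c r) where

  open CommutativeRing R
  open RawSemiringDefs (Semiring.rawSemiring semiring) using (sum)

  Series : Set c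
  Series = ℕ → Carrier

  infix  4 _≋_
  infixl 6 _⊕_
  infixl 7 _⊛_ _•_
  infix  8 ⊖_

  _≋_ : Series → Series → Set r
  f ≋ g = ∀ n → f n ≈ g n

  0ˢ 1ˢ : Series
  0ˢ _       = 0#
  1ˢ zero    = 1#
  1ˢ (suc _) = 0#

  _⊕_ : Series → Series → Series
  (f ⊕ g) n = f n + g n

  ⊖_ : Series → Series
  (⊖ f) n = - f n

  _⊛_ : Series → Series → Series
  (f ⊛ g) n = sum {suc n} λ i → f (toℕ i) * g (n ∸ toℕ i)

  _•_ : Carrier → Series → Series
  (a • f) n = a * f n

  Σˢ : ∀ {n} → Vector Series n → Series
  Σˢ F n = sum λ j → F j n

  IsUnit : Series → Set _
  IsUnit = Algebra.Definitions.Invertible _≋_ 1ˢ _⊛_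

module Adic {ℓ : ℕ} (ℓ-prime : Prime ℓ) where

  instance
    ℓ-nonZero : NonZero ℓ
    ℓ-nonZero = prime⇒nonZero ℓ-prime

  infix 4 _≡[_]_

  _≡[_]_ : ℤ → ℕ → ℤ → Set
  x ≡[ k ] y = + (ℓ ^ k) ∣ x ℤ.- y

  ≡[]-reflexive : ∀ k x y → x ≡ y → x ≡[ k ] y
  ≡[]-reflexive k x _ refl = divides 0ℤ (ℤ.+-inverseʳ x)

  ≡[]-sym : ∀ k x y → x ≡[ k ] y → y ≡[ k ] x
  ≡[]-sym k x y p = subst (_ ∣_) (lem x y) (∣m⇒∣-m p)
    where
    lem : ∀ x y → ℤ.- (x ℤ.- y) ≡ y ℤ.- x
    lem = solve-∀

  ≡[]-trans : ∀ k x y z → x ≡[ k ] y → y ≡[ k ] z → x ≡[ k ] z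
  ≡[]-trans k x y z p q = subst (_ ∣_) (lem x y z) (∣m∣n⇒∣m+n p q)
    where
    lem : ∀ x y z → (x ℤ.- y) ℤ.+ (y ℤ.- z) ≡ x ℤ.- z
    lem = solve-∀

  ≡[]-+ : ∀ k x x′ y y′ → x ≡[ k ] x′ → y ≡[ k ] y′ → x ℤ.+ y ≡[ k ] x′ ℤ.+ y′
  ≡[]-+ k x x′ y y′ p q = subst (_ ∣_) (lem x x′ y y′) (∣m∣n⇒∣m+n p q)
    where
    lem : ∀ x x′ y y′ → (x ℤ.- x′) ℤ.+ (y ℤ.- y′) ≡ (x ℤ.+ y) ℤ.- (x′ ℤ.+ y′)
    lem = solve-∀

  ≡[]-* : ∀ k x x′ y y′ → x ≡[ k ] x′ → y ≡[ k ] y′ → x ℤ.* y ≡[ k ] x′ ℤ.* y′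
  ≡[]-* k x x′ y y′ p q = subst (_ ∣_) (lem x x′ y y′)
    (∣m∣n⇒∣m+n (∣m⇒∣m*n y p) (∣n⇒∣m*n x′ q))
    where
    lem : ∀ x x′ y y′ → (x ℤ.- x′) ℤ.* y ℤ.+ x′ ℤ.* (y ℤ.- y′) ≡ x ℤ.* y ℤ.- x′ ℤ.* y′
    lem = solve-∀

  ≡[]-neg : ∀ k x y → x ≡[ k ] y → ℤ.- x ≡[ k ] ℤ.- y
  ≡[]-neg k x y p = subst (_ ∣_) (lem x y) (∣m⇒∣-m p)
    where
    lem : ∀ x y → ℤ.- (x ℤ.- y) ≡ (ℤ.- x) ℤ.- (ℤ.- y)
    lem = solve-∀

  ≡[]-weaken : ∀ k j x y → x ≡[ k ℕ.+ j ] y → x ≡[ k ] y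
  ≡[]-weaken k j x y p = ∣-trans (∣ᵤ⇒∣ ℓᵏ∣ℓᵏ⁺ʲ) p
    where
    ℓᵏ∣ℓᵏ⁺ʲ : ℓ ^ k ℕ.∣ ℓ ^ (k ℕ.+ j)
    ℓᵏ∣ℓᵏ⁺ʲ = subst (ℓ ^ k ℕ.∣_) (sym (ℕ.^-distribˡ-+-* ℓ k j)) (ℕ.m∣m*n (ℓ ^ j))

  -- ℤ_ℓ as the inverse limit of the rings ℤ/ℓᵏ; the residue modulo ℓᵏ is
  -- given by an integer representative, so equality is the setoid
  -- equality _≈_.

  record ℤₗ : Set where
    constructor mkℤₗ
    field
      approx   : ℕ → ℤ
      coherent : ∀ k → approx (suc k) ≡[ k ] approx k

  open ℤₗ public

  infix 4 _≈_

  record _≈_ (x y : ℤₗ) : Set where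
    constructor mk≈
    field at : ∀ k → approx x k ≡[ k ] approx y k

  open _≈_ public

  fromℤ : ℤ → ℤₗ
  fromℤ a = mkℤₗ (λ _ → a) (λ k → ≡[]-reflexive k a a refl)

  infixl 6 _+_
  infixl 7 _*_
  infix  8 -_

  _+_ _*_ : ℤₗ → ℤₗ → ℤₗ
  x + y = mkℤₗ (λ k → approx x k ℤ.+ approx y k) λ k →
    ≡[]-+ k (approx x (suc k)) _ (approx y (suc k)) _ (coherent x k) (coherent y k)
  x * y = mkℤₗ (λ k → approx x k ℤ.* approx y k) λ k →
    ≡[]-* k (approx x (suc k)) _ (approx y (suc k)) _ (coherent x k) (coherent y k)

  -_ : ℤₗ → ℤₗ
  - x = mkℤₗ (λ k → ℤ.- approx x k) λ k →
    ≡[]-neg k (approx x (suc k)) _ (coherent x k)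

  pointwise : ∀ {x y} → (∀ k → approx x k ≡ approx y k) → x ≈ y
  pointwise {x} {y} p = mk≈ λ k → ≡[]-reflexive k (approx x k) (approx y k) (p k)

  ℤₗ-commutativeRing : CommutativeRing 0ℓ 0ℓ
  ℤₗ-commutativeRing = record
    { Carrier = ℤₗ ; _≈_ = _≈_ ; _+_ = _+_ ; _*_ = _*_ ; -_ = -_
    ; 0# = fromℤ 0ℤ ; 1# = fromℤ 1ℤ
    ; isCommutativeRing = record
      { isRing = record
        { +-isAbelianGroup = record
          { isGroup = record
            { isMonoid = record
              { isSemigroup = record
                { isMagma = record
                  { isEquivalence = record
                    { refl  = pointwise λ _ → refl
                    ; sym   = λ {x} {y} p → mk≈ λ k →
                        ≡[]-sym k (approx x k) (approx y k) (at p k)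
                    ; trans = λ {x} {y} {z} p q → mk≈ λ k →
                        ≡[]-trans k (approx x k) (approx y k) (approx z k) (at p k) (at q k)
                    }
                  ; ∙-cong = λ {x} {x′} {y} {y′} p q → mk≈ λ k →
                      ≡[]-+ k (approx x k) (approx x′ k) (approx y k) (approx y′ k) (at p k) (at q k)
                  }
                ; assoc = λ x y z → pointwise λ k → ℤ.+-assoc (approx x k) (approx y k) (approx z k)
                }
              ; identity = (λ x → pointwise λ k → ℤ.+-identityˡ (approx x k))
                         , (λ x → pointwise λ k → ℤ.+-identityʳ (approx x k))
              }
            ; inverse = (λ x → pointwise λ k → ℤ.+-inverseˡ (approx x k))
                      , (λ x → pointwise λ k → ℤ.+-inverseʳ (approx x k))
            ; ⁻¹-cong = λ {x} {y} p → mk≈ λ k → ≡[]-neg k (approx x k) (approx y k) (at p k)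
            }
          ; comm = λ x y → pointwise λ k → ℤ.+-comm (approx x k) (approx y k)
          }
        ; *-cong = λ {x} {x′} {y} {y′} p q → mk≈ λ k →
            ≡[]-* k (approx x k) (approx x′ k) (approx y k) (approx y′ k) (at p k) (at q k)
        ; *-assoc = λ x y z → pointwise λ k → ℤ.*-assoc (approx x k) (approx y k) (approx z k)
        ; *-identity = (λ x → pointwise λ k → ℤ.*-identityˡ (approx x k))
                     , (λ x → pointwise λ k → ℤ.*-identityʳ (approx x k))
        ; distrib = (λ x y z → pointwise λ k → ℤ.*-distribˡ-+ (approx x k) (approx y k) (approx z k))
                  , (λ x y z → pointwise λ k → ℤ.*-distribʳ-+ (approx x k) (approx y k) (approx z k))
        }
      ; *-comm = λ x y → pointwise λ k → ℤ.*-comm (approx x k) (approx y k)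
      }
    }

  open CommutativeRing ℤₗ-commutativeRing public using (0#; 1#; _-_; semiring)
  open RawSemiringDefs (Semiring.rawSemiring semiring) public using () renaming (_∣_ to _∣ₗ_)

  coherent* : ∀ x k j → approx x (k ℕ.+ j) ≡[ k ] approx x k
  coherent* x k zero    = ≡[]-reflexive k (approx x (k ℕ.+ 0)) (approx x k) (cong (approx x) (ℕ.+-identityʳ k))
  coherent* x k (suc j) = ≡[]-trans k (approx x (k ℕ.+ suc j)) (approx x (k ℕ.+ j)) (approx x k)
    (≡[]-weaken k j (approx x (k ℕ.+ suc j)) (approx x (k ℕ.+ j))
      (subst (λ i → approx x i ≡[ k ℕ.+ j ] approx x (k ℕ.+ j)) (sym (ℕ.+-suc k j))
        (coherent x (k ℕ.+ j))))
    (coherent* x k j)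

  -- As v_ℓ(m) ≤ m, the residue of x modulo ℓᵏ⁺ᵐ determines that of x/m modulo ℓᵏ.

  private
    ∤⇒cancel : ∀ {m} → ¬ (ℓ ℕ.∣ m) → ∀ i d → ℓ ^ i ℕ.∣ m ℕ.* d → ℓ ^ i ℕ.∣ d
    ∤⇒cancel ∤ zero    d _ = ℕ.1∣ d
    ∤⇒cancel {m} ∤ (suc i) d p
      with euclidsLemma m d ℓ-prime (ℕ.∣-trans (ℕ.m∣m*n (ℓ ^ i)) p)
    ... | inj₁ ℓ∣m = ⊥-elim (∤ ℓ∣m)
    ... | inj₂ (ℕ.divides d′ refl) =
      subst (ℓ ℕ.* ℓ ^ i ℕ.∣_) (ℕ.*-comm ℓ d′)
        (ℕ.*-monoʳ-∣ ℓ (∤⇒cancel ∤ i d′ (ℕ.*-cancelˡ-∣ ℓ (subst (ℓ ℕ.* ℓ ^ i ℕ.∣_) eq p))))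
      where
      eq : m ℕ.* (d′ ℕ.* ℓ) ≡ ℓ ℕ.* (m ℕ.* d′)
      eq = trans (sym (ℕ.*-assoc m d′ ℓ)) (ℕ.*-comm (m ℕ.* d′) ℓ)

    cancelℕ : ∀ k j m d → .{{NonZero m}} → m ℕ.≤ j → ℓ ^ (k ℕ.+ j) ℕ.∣ m ℕ.* d → ℓ ^ k ℕ.∣ d
    cancelℕ k zero    m d m≤j p = ⊥-elim (ℕ.≢-nonZero⁻¹ m (ℕ.n≤0⇒n≡0 m≤j))
    cancelℕ k (suc j) m d m≤j p with ℓ ℕ.∣? m
    ... | no ∤ = ℕ.∣-trans
      (subst (ℓ ^ k ℕ.∣_) (sym (ℕ.^-distribˡ-+-* ℓ k (suc j))) (ℕ.m∣m*n (ℓ ^ suc j)))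
      (∤⇒cancel ∤ (k ℕ.+ suc j) d p)
    ... | yes (ℕ.divides m′ refl) = cancelℕ k j m′ d {{nz}} m′≤j
      (ℕ.*-cancelˡ-∣ ℓ (subst (ℕ._∣ ℓ ℕ.* (m′ ℕ.* d)) (cong (ℓ ^_) (ℕ.+-suc k j))
        (subst (ℓ ^ (k ℕ.+ suc j) ℕ.∣_) eq p)))
      where
      nz : NonZero m′
      nz = ℕ.m*n≢0⇒m≢0 m′
      eq : m′ ℕ.* ℓ ℕ.* d ≡ ℓ ℕ.* (m′ ℕ.* d)
      eq = trans (cong (ℕ._* d) (ℕ.*-comm m′ ℓ)) (ℕ.*-assoc ℓ m′ d)
      m′≤j : m′ ℕ.≤ j
      m′≤j = ℕ.s≤s⁻¹ (ℕ.<-≤-trans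
        (ℕ.m<m*n m′ ℓ {{nz}} (ℕ.nonTrivial⇒n>1 ℓ {{prime⇒nonTrivial ℓ-prime}})) m≤j)

  ℓ-cancel : ∀ k m d → .{{NonZero m}} → + (ℓ ^ (k ℕ.+ m)) ∣ + m ℤ.* d → + (ℓ ^ k) ∣ d
  ℓ-cancel k m d p = ∣ᵤ⇒∣ (cancelℕ k m m ℤ.∣ d ∣ ℕ.≤-refl
    (subst (ℓ ^ (k ℕ.+ m) ℕ.∣_) (ℤ.abs-* (+ m) d) (∣⇒∣ᵤ p)))

  divide : (x : ℤₗ) (m : ℕ) .{{_ : NonZero m}} → (∀ k → + m ∣ approx x k) → ℤₗ
  divide x m m∣x = mkℤₗ (λ k → q (k ℕ.+ m)) λ k →
    ℓ-cancel k m _ (subst (+ (ℓ ^ (k ℕ.+ m)) ∣_) (eq k) (coherent x (k ℕ.+ m)))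
    where
    q : ℕ → ℤ
    q k = _∣_.quotient (m∣x k)
    lem : ∀ a b c → a ℤ.* c ℤ.- b ℤ.* c ≡ c ℤ.* (a ℤ.- b)
    lem = solve-∀
    eq : ∀ k → approx x (suc k ℕ.+ m) ℤ.- approx x (k ℕ.+ m)
             ≡ + m ℤ.* (q (suc k ℕ.+ m) ℤ.- q (k ℕ.+ m))
    eq k = trans
      (cong₂ ℤ._-_ (_∣_.equality (m∣x (suc k ℕ.+ m))) (_∣_.equality (m∣x (k ℕ.+ m))))
      (lem (q (suc k ℕ.+ m)) (q (k ℕ.+ m)) (+ m))

  divide-spec : ∀ x m .{{_ : NonZero m}} (m∣x : ∀ k → + m ∣ approx x k) →
                divide x m m∣x * fromℤ (+ m) ≈ x
  divide-spec x m m∣x = mk≈ λ k →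
    subst (_≡[ k ] approx x k) (_∣_.equality (m∣x (k ℕ.+ m))) (coherent* x k m)

  fall : ℤₗ → ℕ → ℤₗ
  fall b zero    = 1#
  fall b (suc n) = fall b n * (b - fromℤ (+ n))

  approx-fall : ∀ b n k → approx (fall b n) k ≡ fallℤ (approx b k) n
  approx-fall b zero    k = refl
  approx-fall b (suc n) k = cong (ℤ._* (approx b k ℤ.- + n)) (approx-fall b n k)

  !∣fallₗ : ∀ b n k → + (n !) ∣ approx (fall b n) k
  !∣fallₗ b n k = subst (+ (n !) ∣_) (sym (approx-fall b n k)) (!∣fall n (approx b k))

  binom : ℤₗ → ℕ → ℤₗ
  binom b n = divide (fall b n) (n !) {{n ℕ.!≢0}} (!∣fallₗ b n)

  binom-spec : ∀ b n → binom b n * fromℤ (+ (n !)) ≈ fall b n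
  binom-spec b n = divide-spec (fall b n) (n !) {{n ℕ.!≢0}} (!∣fallₗ b n)

  open PowerSeries ℤₗ-commutativeRing public

  [1+T]^_ : ℤₗ → Series
  [1+T]^ b = binom b

  -- The bouquet with t loops enters through its characteristic series.

  charSeries : ∀ {t} → Vector ℤₗ t → Series
  charSeries α = Σˢ λ j →
    fromℤ (+ 2) • 1ˢ ⊕ ⊖ [1+T]^ (α j) ⊕ ⊖ [1+T]^ (- α j)

  Admissible : ∀ {t} → Pred (Vector ℤₗ t) 0ℓ
  Admissible α = ¬ (∀ j → fromℤ (+ ℓ) ∣ₗ α j)

  -- A polynomial is a series with vanishing coefficients above its degree.
  record IsDistinguished (g : Series) (d : ℕ) : Set where
    field
      leading    : g d ≈ 1#
      vanishing  : ∀ {i} → d ℕ.< i → g i ≈ 0#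
      divisible  : ∀ {i} → i ℕ.< d → fromℤ (+ ℓ) ∣ₗ g i

  -- The Weierstrass factorization is unique, so μ and λ are single valued.
  -- They are given by their graph because computing μ for an arbitrary
  -- series is not constructively possible.
  WeierstrassFactorization : Series → (μ d : ℕ) → Set
  WeierstrassFactorization f μ d = ∃[ g ] ∃[ u ]
    IsDistinguished g d × IsUnit u × f ≋ fromℤ (+ (ℓ ^ μ)) • (g ⊛ u)

  -- The degree of g is suc λ₀; it is never 0, as the series has zero
  -- constant term.
  HasInvariants : ∀ {t} → Vector ℤₗ t → (μ₀ λ₀ : ℕ) → Set
  HasInvariants α μ₀ λ₀ = WeierstrassFactorization (charSeries α) μ₀ (suc λ₀)

  -- The coset c + (ℓᵏℤ_ℓ)ᵗ.  Every coset has an integral centre, and by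
  -- translation invariance its measure is ℓ⁻ᵏᵗ.
  record Ball (t : ℕ) : Set where
    constructor ball
    field
      centre : Vector ℤ t
      level  : ℕ

  infix 4 _∈ᴮ_

  _∈ᴮ_ : ∀ {t} → Vector ℤₗ t → Ball t → Set
  α ∈ᴮ ball c k = ∀ j → approx (α j) k ≡[ k ] c j

  ℓ^-_ : ℕ → ℚ
  ℓ^- n = _/_ 1ℤ (ℓ ^ n) {{ℕ.m^n≢0 ℓ n}}

  volume : ∀ {t} → Ball t → ℚ
  volume {t} (ball _ k) = ℓ^- (k ℕ.* t)

  -- A countable family of balls; nothing stands for the empty set.
  Family : ℕ → Set
  Family t = ℕ → Maybe (Ball t)

  Covers : ∀ {t} → Family t → Pred (Vector ℤₗ t) 0ℓ → Set
  Covers B S = ∀ α → S α → ∃[ i ] Any (α ∈ᴮ_) (B i)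

  partialVolume : ∀ {t} → Family t → ℕ → ℚ
  partialVolume B N = RawMonoidDefs.sum ℚ.+-0-rawMonoid {N} λ i → maybe volume 0ℚ (B (toℕ i))

  -- τ*(S) ≤ v for the outer measure τ*, the infimum of the total volumes
  -- of countable covers by balls.
  OuterMeasure≤ : ∀ {t} → Pred (Vector ℤₗ t) 0ℓ → ℚ → Set
  OuterMeasure≤ S v = ∀ ε → 0ℚ ℚ.< ε →
    ∃[ B ] Covers B S × (∀ N → partialVolume B N ℚ.≤ v ℚ.+ ε)

  -- S is measurable with τ(S) = v.  Since τ*(S) + τ*(∁ S) ≥ 1, the two
  -- bounds force τ*(S) = v and τ*(S) + τ*(∁ S) = 1, and the latter is
  -- Carathéodory measurability because the total mass is finite.
  HasHaarMeasure : ∀ {t} → Pred (Vector ℤₗ t) 0ℓ → ℚ → Set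
  HasHaarMeasure S v = OuterMeasure≤ S v × OuterMeasure≤ (∁ S) (1ℚ ℚ.- v)

  -- Prob_ℓ(X_t; μ = μ₀, λ = λ₀) = q for t ≥ 1, with the factor
  -- (1 - ℓ⁻ᵗ)⁻¹ moved to the other side.
  HasProb : (t μ₀ λ₀ : ℕ) → ℚ → Set
  HasProb t μ₀ λ₀ q = HasHaarMeasure {t}
    (λ α → Admissible α × HasInvariants α μ₀ λ₀)
    ((1ℚ ℚ.- ℓ^- t) ℚ.* q)

ℓ^t∸1≢0 : ∀ {ℓ t} → Prime ℓ → 2 ℕ.≤ t → NonZero (ℓ ^ t ∸ 1)
ℓ^t∸1≢0 {ℓ} {t} p 2≤t = ℕ.>-nonZero (ℕ.m<n⇒0<n∸m
  (ℕ.^-monoʳ-< ℓ (ℕ.nonTrivial⇒n>1 ℓ {{prime⇒nonTrivial p}}) {0} {t} (ℕ.<-≤-trans (s≤s z≤n) 2≤t)))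

{-# OPTIONS --safe #-}

-- The coefficients of 1 and T in the characteristic series f vanish and that of T² is -∑ αⱼ².
-- So f has μ = 0 and λ = 1 exactly when ℓ ∤ ∑ αⱼ²: then f = T²·u with u a unit, and conversely
-- a distinguished g of degree 2 is T² modulo ℓ.  This depends on α mod ℓ only, and the measure
-- is the proportion of non-zeros of x₁² + … + xₜ² in 𝔽_ℓᵗ.
--
-- The zeros are counted by a recursion from t to t + 4.  Choose a, b with a² + b² = -1; in
-- x² + y² + z² + w² the translation of (z , w) by (ax + by , bx - ay) cancels x² + y², and the
-- form becomes linear in (x , y) for fixed (z , w).  The same device settles t = 3, and t = 2
-- when -1 is a square.

module Submission where

open import Defs
open import Data.Nat using (ℕ; _≤_; _*_; _∸_; _^_)
open import Data.Nat.DivMod using (_/_)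
open import Data.Nat.Divisibility using (_∣_)
open import Data.Nat.Primality using (Prime)
open import Data.Integer using (+_; 1ℤ; -1ℤ)
import Data.Integer as ℤ
open import Data.Rational using (1ℚ)
import Data.Rational as ℚ
open import Data.Product using (_×_)
open import Relation.Nullary using (¬_)

open import Algebra.Bundles using (CommutativeRing)
open import Algebra.Definitions.RawMagma using (_,_)
import Algebra.Definitions.RawMonoid as RawMonoidDefs
import Algebra.Properties.Semiring.Sum as SemiringSum
open import Data.Bool.Base using (Bool; true; false; not; if_then_else_)
open import Data.Empty using (⊥-elim)
open import Data.Fin.Base using (Fin; zero; suc; toℕ; fromℕ<; opposite; splitAt; join)
open import Data.Fin.Permutation using (permutation; reverse)
import Data.Fin.Properties as Fin
open import Data.Integer using (ℤ; 0ℤ)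
import Data.Integer.DivMod as ℤ
import Data.Integer.Divisibility.Signed as ℤ
import Data.Integer.Properties as ℤ
open import Data.Integer.Tactic.RingSolver using (solve-∀)
open import Data.List.Base using (List; []; _∷_; length; map; concat; tabulate)
import Data.List.Properties as List
import Data.List.Relation.Unary.Any as Any
open import Data.List.Relation.Unary.Any using (Any; here; there)
import Data.List.Relation.Unary.Any.Properties as Any
open import Data.Maybe.Base using (just; nothing)
import Data.Maybe.Relation.Unary.Any as Maybe
import Data.Nat as ℕ
open import Data.Nat using (zero; suc; NonZero; z≤n; s≤s)
import Data.Nat.Coprimality as ℕ
open import Data.Nat.DivMod using (m*n/n≡m)
import Data.Nat.Divisibility as ℕ
import Data.Nat.GCD as ℕ
import Data.Nat.Primality as ℕ
import Data.Nat.Properties as ℕ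
import Data.Nat.Tactic.RingSolver as ℕSolver
open import Data.Product using (∃-syntax; _,_; proj₁; proj₂)
import Data.Rational.Properties as ℚ
open import Data.Rational.Solver using (module +-*-Solver)
import Data.Rational.Unnormalised.Base as ℚᵘ
open import Data.Rational.Unnormalised.Base using (mkℚᵘ; *≡*)
import Data.Rational.Unnormalised.Properties as ℚᵘ
open import Data.Sum using (_⊎_; inj₁; inj₂; [_,_]′)
import Data.Vec.Functional as Vector
open import Function using (_∘_)
open import Level using (0ℓ)
open import Relation.Binary.PropositionalEquality
  using (_≡_; _≢_; refl; sym; trans; cong; cong₂; subst; module ≡-Reasoning)
open import Relation.Nullary using (Dec; yes; no; does)
open import Relation.Nullary.Decidable using (dec-true; dec-false; decidable-stable)
open import Relation.Unary using (Pred; ∁)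

-- The recursion from t to t + 4 works because the four-square identity holds for an arbitrary
-- periodic weight `φ`, not only for the indicator of zero. The other t variables are summed into
-- the weight `count t ⟦_⟧`, of which the identity sees only the value at 0 and the total ℓᵗ. A pair
-- with a² + b² = -1 exists for every odd ℓ, so only the case t = 2 asks whether -1 is a square. The
-- sign in the formula is the answer to that question, expressed through the parity of h = (ℓ -
-- 1)/2. This parity comes from comparing a symmetric 0-1 matrix with its diagonal modulo 2. Counts
-- are natural numbers, so an identity with a negative term is stated with that term on the other
-- side. For the measure, both the set and its complement must be covered. Balls of level one do it,
-- and as the numbers of non-zeros and zeros add up to ℓᵗ, the two upper bounds are complementary.
-- The -1 in the numerators is the zero vector: it is a zero of the form but not admissible, and the
-- probability is taken over the ℓᵗ - 1 other residue vectors.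

open SemiringSum ℕ.+-*-semiring
module ℚ× = RawMonoidDefs ℚ.+-0-rawMonoid

-- Finite sums and parity.

sum-const : ∀ n c → sum {n} (λ _ → c) ≡ n ℕ.* c
sum-const zero    c = refl
sum-const (suc n) c = cong (c ℕ.+_) (sum-const n c)

sum-≡0 : ∀ {n} {f : Fin n → ℕ} → (∀ i → f i ≡ 0) → sum f ≡ 0
sum-≡0 {n} f≡0 = trans (sum-cong-≗ f≡0) (trans (sum-const n 0) (ℕ.*-zeroʳ n))

sum-splitAt : ∀ m n (f : ℕ → ℕ) →
  sum {m ℕ.+ n} (f ∘ toℕ) ≡ sum {m} (f ∘ toℕ) ℕ.+ sum {n} (λ j → f (m ℕ.+ toℕ j))
sum-splitAt zero    n f = refl
sum-splitAt (suc m) n f =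
  trans (cong (f 0 ℕ.+_) (sum-splitAt m n (f ∘ suc))) (sym (ℕ.+-assoc (f 0) _ _))

-- Off-diagonal entries come in equal pairs, so the total and the trace agree modulo 2. The
-- induction removes the first row together with the first column.
sum-symmetric : ∀ n (M : Fin n → Fin n → ℕ) → (∀ i j → M i j ≡ M j i) →
  ∃[ k ] sum (λ i → sum (M i)) ≡ sum (λ i → M i i) ℕ.+ (k ℕ.+ k)
sum-symmetric zero    M M-sym = 0 , refl
sum-symmetric (suc n) M M-sym =
  let k , eq = sum-symmetric n (λ i j → M (suc i) (suc j)) (λ i j → M-sym (suc i) (suc j))
      row    = sum λ j → M zero (suc j)
  in row ℕ.+ k , (begin
    M zero zero ℕ.+ row ℕ.+ sum (λ i → M (suc i) zero ℕ.+ sum (λ j → M (suc i) (suc j)))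
      ≡⟨ cong (M zero zero ℕ.+ row ℕ.+_) (∑-distrib-+ (λ i → M (suc i) zero) _) ⟩
    M zero zero ℕ.+ row ℕ.+ (sum (λ i → M (suc i) zero) ℕ.+ sum (λ i → sum (λ j → M (suc i) (suc j))))
      ≡⟨ cong₂ (λ a b → M zero zero ℕ.+ row ℕ.+ (a ℕ.+ b)) (sum-cong-≗ λ i → M-sym (suc i) zero) eq ⟩
    M zero zero ℕ.+ row ℕ.+ (row ℕ.+ (sum (λ i → M (suc i) (suc i)) ℕ.+ (k ℕ.+ k)))
      ≡⟨ lem (M zero zero) row (sum (λ i → M (suc i) (suc i))) k ⟩
    M zero zero ℕ.+ sum (λ i → M (suc i) (suc i)) ℕ.+ (row ℕ.+ k ℕ.+ (row ℕ.+ k)) ∎)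
  where
  open ≡-Reasoning
  lem : ∀ a r d k → a ℕ.+ r ℕ.+ (r ℕ.+ (d ℕ.+ (k ℕ.+ k))) ≡ a ℕ.+ d ℕ.+ (r ℕ.+ k ℕ.+ (r ℕ.+ k))
  lem = ℕSolver.solve-∀

even⊎odd : ∀ n → (∃[ k ] n ≡ k ℕ.+ k) ⊎ (∃[ k ] n ≡ suc (k ℕ.+ k))
even⊎odd zero = inj₁ (0 , refl)
even⊎odd (suc n) with even⊎odd n
... | inj₁ (k , refl) = inj₂ (k , refl)
... | inj₂ (k , refl) = inj₁ (suc k , cong suc (sym (ℕ.+-suc k k)))

2∣k+k : ∀ k → 2 ∣ k ℕ.+ k
2∣k+k k = ℕ.divides k (trans (cong (k ℕ.+_) (sym (ℕ.+-identityʳ k))) (ℕ.*-comm 2 k))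

2∤1+k+k : ∀ k → ¬ (2 ∣ suc (k ℕ.+ k))
2∤1+k+k k p = ℕ.<⇒≱ (s≤s (s≤s z≤n))
  (ℕ.∣⇒≤ (ℕ.∣m+n∣m⇒∣n (subst (2 ∣_) (ℕ.+-comm 1 (k ℕ.+ k)) p) (2∣k+k k)))

even⇒half : ∀ {n} → 2 ∣ n → ∃[ k ] n ≡ k ℕ.+ k
even⇒half {n} 2∣n = [ (λ e → e) , (λ (k , eq) → ⊥-elim (2∤1+k+k k (subst (2 ∣_) eq 2∣n))) ]′ (even⊎odd n)

odd⇒half : ∀ {n} → ¬ (2 ∣ n) → ∃[ k ] n ≡ suc (k ℕ.+ k)
odd⇒half {n} 2∤n = [ (λ (k , eq) → ⊥-elim (2∤n (subst (2 ∣_) (sym eq) (2∣k+k k)))) , (λ e → e) ]′ (even⊎odd n)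

-- Arithmetic modulo the odd prime ℓ.

module Residues {ℓ : ℕ} (ℓ-prime : Prime ℓ) (ℓ-odd : ¬ (2 ∣ ℓ)) where

  private instance
    ℓ≢0 : NonZero ℓ
    ℓ≢0 = ℕ.prime⇒nonZero ℓ-prime

  Z : ℤ → Set
  Z x = + ℓ ℤ.∣ x

  abstract
    Z? : ∀ x → Dec (Z x)
    Z? x = + ℓ ℤ.∣? x

  Z-ℓ : Z (+ ℓ)
  Z-ℓ = ℤ.∣-refl

  Z-0 : Z 0ℤ
  Z-0 = ℤ.divides 0ℤ refl

  Z-+ : ∀ {x y} → Z x → Z y → Z (x ℤ.+ y)
  Z-+ = ℤ.∣m∣n⇒∣m+n

  Z-neg : ∀ {x} → Z x → Z (ℤ.- x)
  Z-neg = ℤ.∣m⇒∣-m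

  Z-*ʳ : ∀ {x} y → Z x → Z (x ℤ.* y)
  Z-*ʳ y = ℤ.∣m⇒∣m*n y

  Z-*ˡ : ∀ {x} y → Z x → Z (y ℤ.* x)
  Z-*ˡ y = ℤ.∣n⇒∣m*n y

  Z-*⁻ : ∀ x y → Z (x ℤ.* y) → Z x ⊎ Z y
  Z-*⁻ x y p with ℕ.euclidsLemma ℤ.∣ x ∣ ℤ.∣ y ∣ ℓ-prime (subst (ℓ ∣_) (ℤ.abs-* x y) (ℤ.∣⇒∣ᵤ p))
  ... | inj₁ q = inj₁ (ℤ.∣ᵤ⇒∣ q)
  ... | inj₂ q = inj₂ (ℤ.∣ᵤ⇒∣ q)

  Z-sq : ∀ x → Z (x ℤ.* x) → Z x
  Z-sq x p = [ (λ q → q) , (λ q → q) ]′ (Z-*⁻ x x p)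

  ¬Z-* : ∀ {x y} → ¬ Z x → ¬ Z y → ¬ Z (x ℤ.* y)
  ¬Z-* {x} {y} ¬x ¬y p = [ ¬x , ¬y ]′ (Z-*⁻ x y p)

  ¬Z-small : ∀ n → 0 ℕ.< n → n ℕ.< ℓ → ¬ Z (+ n)
  ¬Z-small (suc n) _ n<ℓ p = ℕ.<⇒≱ n<ℓ (ℕ.∣⇒≤ (ℤ.∣⇒∣ᵤ p))

  1<ℓ : 1 ℕ.< ℓ
  1<ℓ = ℕ.nonTrivial⇒n>1 ℓ {{ℕ.prime⇒nonTrivial ℓ-prime}}

  2<ℓ : 2 ℕ.< ℓ
  2<ℓ = ℕ.≤∧≢⇒< 1<ℓ λ { refl → ℓ-odd ℕ.∣-refl }

  ¬Z-1 : ¬ Z 1ℤ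
  ¬Z-1 = ¬Z-small 1 (s≤s z≤n) 1<ℓ

  ¬Z-2 : ¬ Z (+ 2)
  ¬Z-2 = ¬Z-small 2 (s≤s z≤n) 2<ℓ

  abstract
    residue : ℤ → Fin ℓ
    residue x = fromℕ< (ℤ.n%ℕd<d x ℓ)

    Z-residue : ∀ x → Z (x ℤ.- + toℕ (residue x))
    Z-residue x = ℤ.divides (x ℤ./ℕ ℓ) (begin
      x ℤ.- + toℕ (residue x)                            ≡⟨ cong (λ n → x ℤ.- + n) (Fin.toℕ-fromℕ< _) ⟩
      x ℤ.- + (x ℤ.%ℕ ℓ)                                 ≡⟨ cong (ℤ._- + (x ℤ.%ℕ ℓ)) (ℤ.a≡a%ℕn+[a/ℕn]*n x ℓ) ⟩
      (+ (x ℤ.%ℕ ℓ) ℤ.+ (x ℤ./ℕ ℓ) ℤ.* + ℓ) ℤ.- + (x ℤ.%ℕ ℓ)  ≡⟨ lem (+ (x ℤ.%ℕ ℓ)) _ ⟩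
      (x ℤ./ℕ ℓ) ℤ.* + ℓ                                 ∎)
      where
      open ≡-Reasoning
      lem : ∀ a b → (a ℤ.+ b) ℤ.- a ≡ b
      lem = solve-∀

  private
    small-unique : ∀ {m n} → m ℕ.≤ n → n ℕ.< ℓ → Z (+ n ℤ.- + m) → n ≡ m
    small-unique {m} {n} m≤n n<ℓ p with n ∸ m in eq
    ... | zero  = ℕ.≤-antisym (ℕ.m∸n≡0⇒m≤n eq) m≤n
    ... | suc d = ⊥-elim (¬Z-small (n ∸ m) (subst (0 ℕ.<_) (sym eq) (s≤s z≤n))
      (ℕ.≤-<-trans (ℕ.m∸n≤m n m) n<ℓ)
      (subst Z (trans (ℤ.m-n≡m⊖n n m) (ℤ.⊖-≥ m≤n)) p))

  Z-flip : ∀ x y → Z (x ℤ.- y) → Z (y ℤ.- x)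
  Z-flip x y p = subst Z (lem x y) (Z-neg p)
    where
    lem : ∀ x y → ℤ.- (x ℤ.- y) ≡ y ℤ.- x
    lem = solve-∀

  Z-trans : ∀ x y z → Z (x ℤ.- y) → Z (y ℤ.- z) → Z (x ℤ.- z)
  Z-trans x y z p q = subst Z (lem x y z) (Z-+ p q)
    where
    lem : ∀ x y z → (x ℤ.- y) ℤ.+ (y ℤ.- z) ≡ x ℤ.- z
    lem = solve-∀

  Z-resp : ∀ x y → Z (x ℤ.- y) → Z x → Z y
  Z-resp x y p q = subst Z (lem x y) (Z-+ (Z-neg p) q)
    where
    lem : ∀ x y → ℤ.- (x ℤ.- y) ℤ.+ x ≡ y
    lem = solve-∀

  residue-unique : ∀ {m n} → m ℕ.< ℓ → n ℕ.< ℓ → Z (+ m ℤ.- + n) → m ≡ n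
  residue-unique {m} {n} m<ℓ n<ℓ p with ℕ.≤-total m n
  ... | inj₁ m≤n = sym (small-unique m≤n n<ℓ (Z-flip (+ m) (+ n) p))
  ... | inj₂ n≤m = small-unique n≤m m<ℓ p

  residue-≡ : ∀ x i → Z (x ℤ.- + toℕ i) → residue x ≡ i
  residue-≡ x i p = Fin.toℕ-injective (residue-unique (Fin.toℕ<n (residue x)) (Fin.toℕ<n i)
    (Z-trans (+ toℕ (residue x)) x (+ toℕ i) (Z-flip x _ (Z-residue x)) p))

  residue-injective : ∀ x y → residue x ≡ residue y → Z (x ℤ.- y)
  residue-injective x y eq = Z-trans x (+ toℕ (residue x)) y (Z-residue x)
    (Z-flip y (+ toℕ (residue x)) (subst (λ r → Z (y ℤ.- + toℕ r)) (sym eq) (Z-residue y)))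

  private
    pos-eq : ∀ a b c d → a ℕ.+ b ℕ.* c ≡ d → + a ℤ.+ + b ℤ.* + c ≡ + d
    pos-eq a b c d eq = trans (cong (λ e → + a ℤ.+ e) (sym (ℤ.pos-* b c))) (cong +_ eq)

    invert-small : ∀ n → 0 ℕ.< n → n ℕ.< ℓ → ∃[ b ] Z (+ n ℤ.* b ℤ.- 1ℤ)
    invert-small n@(suc _) _ n<ℓ with ℕ.coprime-Bézout (ℕ.prime⇒coprime ℓ-prime n<ℓ)
    -- Bézout's identity without subtraction reads `1 + y n = x ℓ` here and `1 + x ℓ = y n` below,
    -- which makes the inverse `- y` or `y`.
    ... | ℕ.Bézout.+- x y eq = ℤ.- + y , ℤ.divides (ℤ.- + x)
      (trans (lem (+ n) (+ y)) (trans (cong ℤ.-_ (trans (pos-eq 1 y n _ eq) (ℤ.pos-* x ℓ)))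
             (ℤ.neg-distribˡ-* (+ x) (+ ℓ))))
      where
      lem : ∀ n y → n ℤ.* (ℤ.- y) ℤ.- 1ℤ ≡ ℤ.- (1ℤ ℤ.+ y ℤ.* n)
      lem = solve-∀
    ... | ℕ.Bézout.-+ x y eq = + y , ℤ.divides (+ x)
      (trans (cong (ℤ._- 1ℤ) (trans (ℤ.*-comm (+ n) (+ y))
               (trans (sym (ℤ.pos-* y n)) (sym (pos-eq 1 x ℓ _ eq)))))
             (lem (+ x ℤ.* + ℓ)))
      where
      lem : ∀ a → (1ℤ ℤ.+ a) ℤ.- 1ℤ ≡ a
      lem = solve-∀

  invert : ∀ {a} → ¬ Z a → ∃[ b ] Z (a ℤ.* b ℤ.- 1ℤ)
  invert {a} ¬Za = let b , p = invert-small n 0<n n<ℓ in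
    b , subst Z (lem a (+ n) b) (Z-+ (Z-*ʳ b (Z-residue a)) p)
    where
    n = toℕ (residue a)
    n<ℓ = Fin.toℕ<n (residue a)
    0<n : 0 ℕ.< n
    0<n = ℕ.n≢0⇒n>0 λ n≡0 → ¬Za (subst Z (trans (cong (λ m → a ℤ.- + m) n≡0) (ℤ.+-identityʳ a)) (Z-residue a))
    lem : ∀ a n b → (a ℤ.- n) ℤ.* b ℤ.+ (n ℤ.* b ℤ.- 1ℤ) ≡ a ℤ.* b ℤ.- 1ℤ
    lem = solve-∀

  -- Sums over a complete set of residues.

  abstract
    ∑ : (ℤ → ℕ) → ℕ
    ∑ φ = sum {ℓ} λ i → φ (+ toℕ i)

    ∑-def : ∀ φ → ∑ φ ≡ sum {ℓ} λ i → φ (+ toℕ i)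
    ∑-def φ = refl

    ∑-cong : ∀ {φ ψ} → (∀ x → φ x ≡ ψ x) → ∑ φ ≡ ∑ ψ
    ∑-cong eq = sum-cong-≗ {ℓ} λ i → eq (+ toℕ i)

    ∑-+ : ∀ φ ψ → ∑ (λ x → φ x ℕ.+ ψ x) ≡ ∑ φ ℕ.+ ∑ ψ
    ∑-+ φ ψ = ∑-distrib-+ {ℓ} (φ ∘ +_ ∘ toℕ) (ψ ∘ +_ ∘ toℕ)

    ∑-*ʳ : ∀ φ c → ∑ (λ x → φ x ℕ.* c) ≡ ∑ φ ℕ.* c
    ∑-*ʳ φ c = sym (*-distribʳ-sum {ℓ} c (φ ∘ +_ ∘ toℕ))

    ∑-const : ∀ c → ∑ (λ _ → c) ≡ ℓ ℕ.* c
    ∑-const = sum-const ℓ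

    ∑-swap : ∀ (φ : ℤ → ℤ → ℕ) → ∑ (λ x → ∑ (λ y → φ x y)) ≡ ∑ (λ y → ∑ (λ x → φ x y))
    ∑-swap φ = ∑-comm {ℓ} {ℓ} λ i j → φ (+ toℕ i) (+ toℕ j)

  Periodic : (ℤ → ℕ) → Set
  Periodic φ = ∀ x y → Z (x ℤ.- y) → φ x ≡ φ y

  -- The map x ↦ ax + b permutes the residues; its inverse is y ↦ c(y - b) with ac = 1.
  ∑-affine : ∀ {φ} → Periodic φ → ∀ {a} → ¬ Z a → ∀ b → ∑ (λ x → φ (a ℤ.* x ℤ.+ b)) ≡ ∑ φ
  ∑-affine {φ} per {a} ¬Za b = sym (begin
    ∑ φ                                    ≡⟨ ∑-def φ ⟩
    sum {ℓ} (φ ∘ +_ ∘ toℕ)                 ≡⟨ sum-permute (φ ∘ +_ ∘ toℕ) π ⟩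
    sum {ℓ} (λ i → φ (+ toℕ (to i)))
      ≡⟨ sum-cong-≗ {ℓ} {λ i → φ (+ toℕ (to i))}
           (λ i → sym (per (a ℤ.* + toℕ i ℤ.+ b) _ (Z-residue (a ℤ.* + toℕ i ℤ.+ b)))) ⟩
    sum {ℓ} (λ i → φ (a ℤ.* + toℕ i ℤ.+ b))  ≡⟨ ∑-def (λ x → φ (a ℤ.* x ℤ.+ b)) ⟨
    ∑ (λ x → φ (a ℤ.* x ℤ.+ b))            ∎)
    where
    open ≡-Reasoning
    c = proj₁ (invert ¬Za)
    ac≡1 = proj₂ (invert ¬Za)
    to from : Fin ℓ → Fin ℓ
    to   i = residue (a ℤ.* + toℕ i ℤ.+ b)
    from i = residue (c ℤ.* (+ toℕ i ℤ.- b))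
    lem₁ : ∀ a b c y f → (a ℤ.* c ℤ.- 1ℤ) ℤ.* (y ℤ.- b) ℤ.+ (ℤ.- (a ℤ.* (c ℤ.* (y ℤ.- b) ℤ.- f)))
                         ≡ (a ℤ.* f ℤ.+ b) ℤ.- y
    lem₁ = solve-∀
    lem₂ : ∀ a b c y f → (a ℤ.* c ℤ.- 1ℤ) ℤ.* y ℤ.+ (ℤ.- (c ℤ.* ((a ℤ.* y ℤ.+ b) ℤ.- f)))
                         ≡ (c ℤ.* (f ℤ.- b)) ℤ.- y
    lem₂ = solve-∀
    π = permutation to from
      (λ j → residue-≡ _ j (subst Z (lem₁ a b c (+ toℕ j) (+ toℕ (from j)))
        (Z-+ (Z-*ʳ (+ toℕ j ℤ.- b) ac≡1) (Z-neg (Z-*ˡ a (Z-residue (c ℤ.* (+ toℕ j ℤ.- b))))))))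
      (λ i → residue-≡ _ i (subst Z (lem₂ a b c (+ toℕ i) (+ toℕ (to i)))
        (Z-+ (Z-*ʳ (+ toℕ i) ac≡1) (Z-neg (Z-*ˡ c (Z-residue (a ℤ.* + toℕ i ℤ.+ b)))))))

  ∑-shift : ∀ {φ} → Periodic φ → ∀ b → ∑ (λ x → φ (x ℤ.+ b)) ≡ ∑ φ
  ∑-shift {φ} per b =
    trans (∑-cong λ x → cong (λ y → φ (y ℤ.+ b)) (sym (ℤ.*-identityˡ x))) (∑-affine per ¬Z-1 b)

  ⟦_⟧ : ℤ → ℕ
  ⟦ x ⟧ = if does (Z? x) then 1 else 0

  ⟦⟧≡1 : ∀ {x} → Z x → ⟦ x ⟧ ≡ 1
  ⟦⟧≡1 {x} p with Z? x
  ... | yes _ = refl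
  ... | no ¬p = ⊥-elim (¬p p)

  ⟦⟧≡0 : ∀ {x} → ¬ Z x → ⟦ x ⟧ ≡ 0
  ⟦⟧≡0 {x} ¬p with Z? x
  ... | yes p = ⊥-elim (¬p p)
  ... | no _  = refl

  ⟦⟧-cong : ∀ {x y} → (Z x → Z y) → (Z y → Z x) → ⟦ x ⟧ ≡ ⟦ y ⟧
  ⟦⟧-cong {x} {y} f g with Z? y
  ... | yes q = ⟦⟧≡1 (g q)
  ... | no ¬q = ⟦⟧≡0 (¬q ∘ f)

  ⟦⟧-periodic : Periodic ⟦_⟧
  ⟦⟧-periodic x y p = ⟦⟧-cong (Z-resp x y p) (Z-resp y x (Z-flip x y p))

  ∑⟦⟧ : ∑ ⟦_⟧ ≡ 1
  ∑⟦⟧ = trans (∑-def ⟦_⟧) (go ℓ refl)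
    where
    go : ∀ n → n ≡ ℓ → sum {n} (λ i → ⟦ + toℕ i ⟧) ≡ 1
    go zero    eq = ⊥-elim (ℕ.≢-nonZero⁻¹ ℓ (sym eq))
    go (suc n) eq = cong₂ ℕ._+_ (⟦⟧≡1 Z-0)
      (sum-≡0 λ i → ⟦⟧≡0 (¬Z-small (suc (toℕ i)) (s≤s z≤n) (subst (suc (toℕ i) ℕ.<_) eq (s≤s (Fin.toℕ<n i)))))

  ∑⟦affine⟧ : ∀ {a} → ¬ Z a → ∀ b → ∑ (λ x → ⟦ a ℤ.* x ℤ.+ b ⟧) ≡ 1
  ∑⟦affine⟧ ¬Za b = trans (∑-affine ⟦⟧-periodic ¬Za b) ∑⟦⟧

  ⟦⟧⟦⟧≡1 : ∀ {x y} → Z x → Z y → ⟦ x ⟧ ℕ.* ⟦ y ⟧ ≡ 1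
  ⟦⟧⟦⟧≡1 p q = cong₂ ℕ._*_ (⟦⟧≡1 p) (⟦⟧≡1 q)

  ⟦⟧⟦⟧≡0 : ∀ {x y} → ¬ (Z x × Z y) → ⟦ x ⟧ ℕ.* ⟦ y ⟧ ≡ 0
  ⟦⟧⟦⟧≡0 {x} {y} ¬both with Z? x
  ... | no _  = refl
  ... | yes p = trans (ℕ.+-identityʳ ⟦ y ⟧) (⟦⟧≡0 λ q → ¬both (p , q))

  ⟦⟧≡⟦⟧⟦⟧ : ∀ {s x y} → (Z s → Z x × Z y) → (Z x → Z y → Z s) → ⟦ s ⟧ ≡ ⟦ x ⟧ ℕ.* ⟦ y ⟧
  ⟦⟧≡⟦⟧⟦⟧ {s} {x} {y} to from = go (Z? s)
    where
    go : Dec (Z s) → ⟦ s ⟧ ≡ ⟦ x ⟧ ℕ.* ⟦ y ⟧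
    go (yes p) = trans (⟦⟧≡1 p) (sym (⟦⟧⟦⟧≡1 (proj₁ (to p)) (proj₂ (to p))))
    go (no ¬p) = trans (⟦⟧≡0 ¬p) (sym (⟦⟧⟦⟧≡0 λ (q , r) → ¬p (from q r)))

  -- A weight concentrated at the origin. It lets one exceptional point enter a double sum as a
  -- correction term, so that every point satisfies the same equation.
  ∑∑⟦⟧⟦⟧* : ∀ c → ∑ (λ x → ∑ λ y → ⟦ x ⟧ ℕ.* ⟦ y ⟧ ℕ.* c) ≡ c
  ∑∑⟦⟧⟦⟧* c = begin
    ∑ (λ x → ∑ λ y → ⟦ x ⟧ ℕ.* ⟦ y ⟧ ℕ.* c)  ≡⟨ ∑-cong (λ x → ∑-cong λ y → lem ⟦ x ⟧ ⟦ y ⟧ c) ⟩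
    ∑ (λ x → ∑ λ y → ⟦ y ⟧ ℕ.* (⟦ x ⟧ ℕ.* c))  ≡⟨ ∑-cong (λ x → ∑-*ʳ ⟦_⟧ (⟦ x ⟧ ℕ.* c)) ⟩
    ∑ (λ x → ∑ ⟦_⟧ ℕ.* (⟦ x ⟧ ℕ.* c))          ≡⟨ ∑-cong (λ x → trans (cong (ℕ._* (⟦ x ⟧ ℕ.* c)) ∑⟦⟧) (ℕ.*-identityˡ _)) ⟩
    ∑ (λ x → ⟦ x ⟧ ℕ.* c)                      ≡⟨ ∑-*ʳ ⟦_⟧ c ⟩
    ∑ ⟦_⟧ ℕ.* c                                ≡⟨ trans (cong (ℕ._* c) ∑⟦⟧) (ℕ.*-identityˡ c) ⟩
    c                                          ∎
    where
    open ≡-Reasoning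
    lem : ∀ x y c → x ℕ.* y ℕ.* c ≡ y ℕ.* (x ℕ.* c)
    lem = ℕSolver.solve-∀

  ∑∑-+ : ∀ (φ ψ : ℤ → ℤ → ℕ) →
    ∑ (λ x → ∑ λ y → φ x y ℕ.+ ψ x y) ≡ ∑ (λ x → ∑ (φ x)) ℕ.+ ∑ (λ x → ∑ (ψ x))
  ∑∑-+ φ ψ = trans (∑-cong λ x → ∑-+ (φ x) (ψ x)) (∑-+ (λ x → ∑ (φ x)) (λ x → ∑ (ψ x)))

  ∑∑-const : ∀ c → ∑ (λ _ → ∑ (λ _ → c)) ≡ ℓ ℕ.* (ℓ ℕ.* c)
  ∑∑-const c = trans (∑-cong λ _ → ∑-const c) (∑-const (ℓ ℕ.* c))

  ¬Z-m+m : ∀ {m} → ¬ Z m → ¬ Z (m ℤ.+ m)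
  ¬Z-m+m {m} ¬m p = ¬Z-* ¬Z-2 ¬m (subst Z (lem m) p)
    where
    lem : ∀ m → m ℤ.+ m ≡ (1ℤ ℤ.+ 1ℤ) ℤ.* m
    lem = solve-∀

  -- The change of variable behind the translations: `p` may depend on variables of outer sums,
  -- since these are constant inside this one.
  ∑-square-shift : ∀ {φ} → Periodic φ → ∀ c p →
    ∑ (λ x → φ (c ℤ.+ x ℤ.* x)) ≡ ∑ (λ x → φ (c ℤ.+ (x ℤ.+ p) ℤ.* (x ℤ.+ p)))
  ∑-square-shift {φ} per c p = sym (∑-shift {λ x → φ (c ℤ.+ x ℤ.* x)} (λ x y q → per _ _ (subst Z (lem x y c) (Z-*ʳ (x ℤ.+ y) q))) p)
    where
    lem : ∀ x y c → (x ℤ.- y) ℤ.* (x ℤ.+ y) ≡ (c ℤ.+ x ℤ.* x) ℤ.- (c ℤ.+ y ℤ.* y)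
    lem = solve-∀

  -- Weighted sums over values of x₁² + ... + xₜ².

  -- count t φ c is the sum of φ (c + x₁² + … + xₜ²) over 𝔽_ℓᵗ.
  count : ℕ → (ℤ → ℕ) → ℤ → ℕ
  count zero    φ c = φ c
  count (suc t) φ c = ∑ λ x → count t φ (c ℤ.+ x ℤ.* x)

  count-periodic : ∀ t {φ} → Periodic φ → Periodic (count t φ)
  count-periodic zero    per = per
  count-periodic (suc t) per c d p = ∑-cong λ x → count-periodic t per _ _ (subst Z (lem c d x) p)
    where
    lem : ∀ c d x → c ℤ.- d ≡ (c ℤ.+ x ℤ.* x) ℤ.- (d ℤ.+ x ℤ.* x)
    lem = solve-∀

  -- Once the sum over `c` is innermost, each square acts as a translation and does not change it.
  ∑-count : ∀ t {φ} → Periodic φ → ∑ (count t φ) ≡ ℓ ^ t ℕ.* ∑ φ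
  ∑-count zero    {φ} per = sym (ℕ.*-identityˡ (∑ φ))
  ∑-count (suc t) {φ} per = begin
    ∑ (λ c → ∑ λ x → count t φ (c ℤ.+ x ℤ.* x))  ≡⟨ ∑-swap (λ c x → count t φ (c ℤ.+ x ℤ.* x)) ⟩
    ∑ (λ x → ∑ λ c → count t φ (c ℤ.+ x ℤ.* x))  ≡⟨ ∑-cong (λ x → ∑-shift (count-periodic t per) (x ℤ.* x)) ⟩
    ∑ (λ _ → ∑ (count t φ))                      ≡⟨ ∑-const (∑ (count t φ)) ⟩
    ℓ ℕ.* ∑ (count t φ)                          ≡⟨ cong (ℓ ℕ.*_) (∑-count t per) ⟩
    ℓ ℕ.* (ℓ ^ t ℕ.* ∑ φ)                        ≡⟨ sym (ℕ.*-assoc ℓ (ℓ ^ t) (∑ φ)) ⟩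
    ℓ ^ suc t ℕ.* ∑ φ                            ∎
    where open ≡-Reasoning

  module _ {φ : ℤ → ℕ} (per : Periodic φ) (m n s : ℤ) where

    private
      F : ℤ → ℤ → ℕ
      F x y = φ (m ℤ.* x ℤ.+ (n ℤ.* y ℤ.+ s))

    -- With the other variable fixed, the form is affine with invertible slope and takes each
    -- residue once. The sum over `x` has to be innermost for this, hence the exchange.
    ∑∑-affineˡ : ¬ Z m → ∑ (λ x → ∑ (F x)) ≡ ℓ ℕ.* ∑ φ
    ∑∑-affineˡ ¬m = trans (∑-swap F)
      (trans (∑-cong λ y → ∑-affine per ¬m (n ℤ.* y ℤ.+ s)) (∑-const (∑ φ)))

    ∑∑-affineʳ : ¬ Z n → ∑ (λ x → ∑ (F x)) ≡ ℓ ℕ.* ∑ φ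
    ∑∑-affineʳ ¬n = trans
      (∑-cong λ x → trans (∑-cong λ y → cong φ (lem (m ℤ.* x) (n ℤ.* y) s)) (∑-affine per ¬n (m ℤ.* x ℤ.+ s)))
      (∑-const (∑ φ))
      where
      lem : ∀ u v s → u ℤ.+ (v ℤ.+ s) ≡ v ℤ.+ (u ℤ.+ s)
      lem = solve-∀

    ∑∑-affine-0 : Z m → Z n → Z s → ∑ (λ x → ∑ (F x)) ≡ ℓ ℕ.* (ℓ ℕ.* φ 0ℤ)
    ∑∑-affine-0 p q r = trans
      (∑-cong λ x → ∑-cong λ y → per _ 0ℤ (subst Z (sym (ℤ.+-identityʳ _)) (Z-+ (Z-*ʳ x p) (Z-+ (Z-*ʳ y q) r))))
      (∑∑-const (φ 0ℤ))

  -- Linearizing sums of squares by translations.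

  module Isotropic (a b : ℤ) (a²+b²≡-1 : Z (a ℤ.* a ℤ.+ b ℤ.* b ℤ.+ 1ℤ)) where

    -- For fixed (z , w) the translated form is 2mx + 2ny + z² + w² with m = az + bw and n = bz -
    -- aw. The matrix taking (z , w) to (m , n) has determinant -(a² + b²) = 1, so (m , n) vanishes
    -- only at the origin. There the sum over (x , y) is ℓ²φ(0); at the other ℓ² - 1 points it is
    -- ℓ∑φ. The summand on the left supplies the missing ℓ∑φ of the origin.
    four-squares : ∀ {φ} → Periodic φ →
      count 4 φ 0ℤ ℕ.+ ℓ ℕ.* ∑ φ ≡ ℓ ℕ.* (ℓ ℕ.* φ 0ℤ) ℕ.+ ℓ ℕ.* (ℓ ℕ.* (ℓ ℕ.* ∑ φ))
    four-squares {φ} per = begin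
      count 4 φ 0ℤ ℕ.+ ℓ ℕ.* ∑ φ
        ≡⟨ cong₂ ℕ._+_ reorder (sym (∑∑⟦⟧⟦⟧* (ℓ ℕ.* ∑ φ))) ⟩
      ∑ (λ z → ∑ (G z)) ℕ.+ ∑ (λ z → ∑ λ w → ⟦ z ⟧ ℕ.* ⟦ w ⟧ ℕ.* (ℓ ℕ.* ∑ φ))
        ≡⟨ sym (∑∑-+ G (λ z w → ⟦ z ⟧ ℕ.* ⟦ w ⟧ ℕ.* (ℓ ℕ.* ∑ φ))) ⟩
      ∑ (λ z → ∑ λ w → G z w ℕ.+ ⟦ z ⟧ ℕ.* ⟦ w ⟧ ℕ.* (ℓ ℕ.* ∑ φ))
        ≡⟨ ∑-cong (λ z → ∑-cong λ w → G-value z w) ⟩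
      ∑ (λ z → ∑ λ w → ⟦ z ⟧ ℕ.* ⟦ w ⟧ ℕ.* (ℓ ℕ.* (ℓ ℕ.* φ 0ℤ)) ℕ.+ ℓ ℕ.* ∑ φ)
        ≡⟨ ∑∑-+ (λ z w → ⟦ z ⟧ ℕ.* ⟦ w ⟧ ℕ.* (ℓ ℕ.* (ℓ ℕ.* φ 0ℤ))) (λ _ _ → ℓ ℕ.* ∑ φ) ⟩
      ∑ (λ z → ∑ λ w → ⟦ z ⟧ ℕ.* ⟦ w ⟧ ℕ.* (ℓ ℕ.* (ℓ ℕ.* φ 0ℤ))) ℕ.+ ∑ (λ _ → ∑ λ _ → ℓ ℕ.* ∑ φ)
        ≡⟨ cong₂ ℕ._+_ (∑∑⟦⟧⟦⟧* (ℓ ℕ.* (ℓ ℕ.* φ 0ℤ))) (∑∑-const (ℓ ℕ.* ∑ φ)) ⟩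
      ℓ ℕ.* (ℓ ℕ.* φ 0ℤ) ℕ.+ ℓ ℕ.* (ℓ ℕ.* (ℓ ℕ.* ∑ φ)) ∎
      where
      open ≡-Reasoning
      m n : ℤ → ℤ → ℤ
      m z w = a ℤ.* z ℤ.+ b ℤ.* w
      n z w = b ℤ.* z ℤ.- a ℤ.* w
      F : ℤ → ℤ → ℤ → ℤ → ℕ
      F x y z w = φ ((m z w ℤ.+ m z w) ℤ.* x ℤ.+ ((n z w ℤ.+ n z w) ℤ.* y ℤ.+ (z ℤ.* z ℤ.+ w ℤ.* w)))
      G : ℤ → ℤ → ℕ
      G z w = ∑ λ x → ∑ λ y → F x y z w

      expand : ∀ a b x y z w →
        (a ℤ.* a ℤ.+ b ℤ.* b ℤ.+ 1ℤ) ℤ.* (x ℤ.* x ℤ.+ y ℤ.* y) ≡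
        (0ℤ ℤ.+ x ℤ.* x ℤ.+ y ℤ.* y ℤ.+ (z ℤ.+ (a ℤ.* x ℤ.+ b ℤ.* y)) ℤ.* (z ℤ.+ (a ℤ.* x ℤ.+ b ℤ.* y))
          ℤ.+ (w ℤ.+ (b ℤ.* x ℤ.- a ℤ.* y)) ℤ.* (w ℤ.+ (b ℤ.* x ℤ.- a ℤ.* y)))
        ℤ.- (((a ℤ.* z ℤ.+ b ℤ.* w) ℤ.+ (a ℤ.* z ℤ.+ b ℤ.* w)) ℤ.* x ℤ.+ (((b ℤ.* z ℤ.- a ℤ.* w) ℤ.+ (b ℤ.* z ℤ.- a ℤ.* w)) ℤ.* y ℤ.+ (z ℤ.* z ℤ.+ w ℤ.* w)))
      expand = solve-∀

      -- Translating (z , w) by (ax + by , bx - ay) cancels the squares of x and y.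
      linearize : ∀ x y → count 2 φ (0ℤ ℤ.+ x ℤ.* x ℤ.+ y ℤ.* y) ≡ ∑ (λ z → ∑ λ w → F x y z w)
      linearize x y = trans
        (∑-square-shift (count-periodic 1 per) (0ℤ ℤ.+ x ℤ.* x ℤ.+ y ℤ.* y) (a ℤ.* x ℤ.+ b ℤ.* y))
        (∑-cong λ z → trans (∑-square-shift per (0ℤ ℤ.+ x ℤ.* x ℤ.+ y ℤ.* y ℤ.+ (z ℤ.+ (a ℤ.* x ℤ.+ b ℤ.* y)) ℤ.* (z ℤ.+ (a ℤ.* x ℤ.+ b ℤ.* y))) (b ℤ.* x ℤ.- a ℤ.* y))
          (∑-cong λ w → per _ _ (subst Z (expand a b x y z w) (Z-*ʳ (x ℤ.* x ℤ.+ y ℤ.* y) a²+b²≡-1))))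

      reorder : count 4 φ 0ℤ ≡ ∑ (λ z → ∑ (G z))
      reorder = begin
        count 4 φ 0ℤ                                ≡⟨ ∑-cong (λ x → ∑-cong λ y → linearize x y) ⟩
        ∑ (λ x → ∑ λ y → ∑ λ z → ∑ λ w → F x y z w)  ≡⟨ ∑-cong (λ x → ∑-swap λ y z → ∑ λ w → F x y z w) ⟩
        ∑ (λ x → ∑ λ z → ∑ λ y → ∑ λ w → F x y z w)  ≡⟨ ∑-swap (λ x z → ∑ λ y → ∑ λ w → F x y z w) ⟩
        ∑ (λ z → ∑ λ x → ∑ λ y → ∑ λ w → F x y z w)  ≡⟨ ∑-cong (λ z → ∑-cong λ x → ∑-swap λ y w → F x y z w) ⟩
        ∑ (λ z → ∑ λ x → ∑ λ w → ∑ λ y → F x y z w)  ≡⟨ ∑-cong (λ z → ∑-swap λ x w → ∑ λ y → F x y z w) ⟩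
        ∑ (λ z → ∑ (G z))                            ∎

      -- Up to sign the matrix is its own inverse: am + bn = (a² + b²)z and bm - an = (a² + b²)w.
      solve-z : ∀ a b z w → (a ℤ.* a ℤ.+ b ℤ.* b ℤ.+ 1ℤ) ℤ.* z
        ℤ.+ ℤ.- ((a ℤ.* z ℤ.+ b ℤ.* w) ℤ.* a ℤ.+ (b ℤ.* z ℤ.- a ℤ.* w) ℤ.* b) ≡ z
      solve-z = solve-∀
      solve-w : ∀ a b z w → (a ℤ.* a ℤ.+ b ℤ.* b ℤ.+ 1ℤ) ℤ.* w
        ℤ.+ ℤ.- ((a ℤ.* z ℤ.+ b ℤ.* w) ℤ.* b ℤ.+ (b ℤ.* z ℤ.- a ℤ.* w) ℤ.* (ℤ.- a)) ≡ w
      solve-w = solve-∀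

      Z-z : ∀ {z w} → Z (m z w) → Z (n z w) → Z z
      Z-z {z} {w} p q = subst Z (solve-z a b z w)
        (Z-+ (Z-*ʳ z a²+b²≡-1) (Z-neg (Z-+ (Z-*ʳ a p) (Z-*ʳ b q))))

      Z-w : ∀ {z w} → Z (m z w) → Z (n z w) → Z w
      Z-w {z} {w} p q = subst Z (solve-w a b z w)
        (Z-+ (Z-*ʳ w a²+b²≡-1) (Z-neg (Z-+ (Z-*ʳ b p) (Z-*ʳ (ℤ.- a) q))))

      G-value : ∀ z w → G z w ℕ.+ ⟦ z ⟧ ℕ.* ⟦ w ⟧ ℕ.* (ℓ ℕ.* ∑ φ)
                      ≡ ⟦ z ⟧ ℕ.* ⟦ w ⟧ ℕ.* (ℓ ℕ.* (ℓ ℕ.* φ 0ℤ)) ℕ.+ ℓ ℕ.* ∑ φ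
      G-value z w = go (Z? (m z w)) (Z? (n z w))
        where
        Value : ℕ → ℕ → Set
        Value g δ = g ℕ.+ δ ℕ.* (ℓ ℕ.* ∑ φ) ≡ δ ℕ.* (ℓ ℕ.* (ℓ ℕ.* φ 0ℤ)) ℕ.+ ℓ ℕ.* ∑ φ
        isotropic : ∀ {g δ} → g ≡ ℓ ℕ.* (ℓ ℕ.* φ 0ℤ) → δ ≡ 1 → Value g δ
        isotropic refl refl = cong₂ ℕ._+_ (sym (ℕ.+-identityʳ _)) (ℕ.+-identityʳ (ℓ ℕ.* ∑ φ))
        generic : ∀ {g δ} → g ≡ ℓ ℕ.* ∑ φ → δ ≡ 0 → Value g δ
        generic refl refl = ℕ.+-identityʳ _
        go : Dec (Z (m z w)) → Dec (Z (n z w)) → Value (G z w) (⟦ z ⟧ ℕ.* ⟦ w ⟧)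
        go (yes p) (yes q) = isotropic
          (∑∑-affine-0 per (m z w ℤ.+ m z w) (n z w ℤ.+ n z w) (z ℤ.* z ℤ.+ w ℤ.* w)
            (Z-+ p p) (Z-+ q q) (Z-+ (Z-*ʳ z (Z-z p q)) (Z-*ʳ w (Z-w p q))))
          (⟦⟧⟦⟧≡1 (Z-z p q) (Z-w p q))
        go (no ¬p) _ = generic
          (∑∑-affineˡ per (m z w ℤ.+ m z w) (n z w ℤ.+ n z w) (z ℤ.* z ℤ.+ w ℤ.* w) (¬Z-m+m ¬p))
          (⟦⟧⟦⟧≡0 λ (p , q) → ¬p (Z-+ (Z-*ˡ a p) (Z-*ˡ b q)))
        go (yes _) (no ¬q) = generic
          (∑∑-affineʳ per (m z w ℤ.+ m z w) (n z w ℤ.+ n z w) (z ℤ.* z ℤ.+ w ℤ.* w) (¬Z-m+m ¬q))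
          (⟦⟧⟦⟧≡0 λ (p , q) → ¬q (Z-+ (Z-*ˡ b p) (Z-neg (Z-*ˡ a q))))

    -- Translating (y , z) by (ax , bx) leaves 2(ay + bz)x + y² + z². Off the line ay + bz = 0 there
    -- is exactly one `x`, which gives ℓ² - ℓ zeros. On the line the points are s(b , -a), where y²
    -- + z² = -s², so only the origin contributes, with all ℓ values of `x`.
    three-squares : count 3 ⟦_⟧ 0ℤ ≡ ℓ ℕ.* ℓ
    three-squares = ℕ.+-cancelʳ-≡ ℓ _ _ (begin
      count 3 ⟦_⟧ 0ℤ ℕ.+ ℓ                            ≡⟨ cong₂ ℕ._+_ reorder (sym line) ⟩
      ∑ (λ y → ∑ (G y)) ℕ.+ ∑ (λ y → ∑ λ z → ⟦ m y z ⟧)  ≡⟨ sym (∑∑-+ G (λ y z → ⟦ m y z ⟧)) ⟩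
      ∑ (λ y → ∑ λ z → G y z ℕ.+ ⟦ m y z ⟧)            ≡⟨ ∑-cong (λ y → ∑-cong λ z → G-value y z) ⟩
      ∑ (λ y → ∑ λ z → 1 ℕ.+ ⟦ y ⟧ ℕ.* ⟦ z ⟧ ℕ.* ℓ)     ≡⟨ ∑∑-+ (λ _ _ → 1) (λ y z → ⟦ y ⟧ ℕ.* ⟦ z ⟧ ℕ.* ℓ) ⟩
      ∑ (λ _ → ∑ λ _ → 1) ℕ.+ ∑ (λ y → ∑ λ z → ⟦ y ⟧ ℕ.* ⟦ z ⟧ ℕ.* ℓ)
        ≡⟨ cong₂ ℕ._+_ (trans (∑∑-const 1) (cong (ℓ ℕ.*_) (ℕ.*-identityʳ ℓ))) (∑∑⟦⟧⟦⟧* ℓ) ⟩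
      ℓ ℕ.* ℓ ℕ.+ ℓ ∎)
      where
      open ≡-Reasoning
      m : ℤ → ℤ → ℤ
      m y z = a ℤ.* y ℤ.+ b ℤ.* z
      F : ℤ → ℤ → ℤ → ℕ
      F x y z = ⟦ (m y z ℤ.+ m y z) ℤ.* x ℤ.+ (y ℤ.* y ℤ.+ z ℤ.* z) ⟧
      G : ℤ → ℤ → ℕ
      G y z = ∑ λ x → F x y z

      expand : ∀ a b x y z → (a ℤ.* a ℤ.+ b ℤ.* b ℤ.+ 1ℤ) ℤ.* (x ℤ.* x) ≡
        (0ℤ ℤ.+ x ℤ.* x ℤ.+ (y ℤ.+ a ℤ.* x) ℤ.* (y ℤ.+ a ℤ.* x) ℤ.+ (z ℤ.+ b ℤ.* x) ℤ.* (z ℤ.+ b ℤ.* x))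
        ℤ.- (((a ℤ.* y ℤ.+ b ℤ.* z) ℤ.+ (a ℤ.* y ℤ.+ b ℤ.* z)) ℤ.* x ℤ.+ (y ℤ.* y ℤ.+ z ℤ.* z))
      expand = solve-∀

      reorder : count 3 ⟦_⟧ 0ℤ ≡ ∑ (λ y → ∑ (G y))
      reorder = begin
        count 3 ⟦_⟧ 0ℤ
          ≡⟨ ∑-cong (λ x → trans (∑-square-shift (count-periodic 1 ⟦⟧-periodic) (0ℤ ℤ.+ x ℤ.* x) (a ℤ.* x))
             (∑-cong λ y → trans (∑-square-shift ⟦⟧-periodic (0ℤ ℤ.+ x ℤ.* x ℤ.+ (y ℤ.+ a ℤ.* x) ℤ.* (y ℤ.+ a ℤ.* x)) (b ℤ.* x))
             (∑-cong λ z → ⟦⟧-periodic _ _ (subst Z (expand a b x y z) (Z-*ʳ (x ℤ.* x) a²+b²≡-1))))) ⟩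
        ∑ (λ x → ∑ λ y → ∑ λ z → F x y z)  ≡⟨ ∑-swap (λ x y → ∑ λ z → F x y z) ⟩
        ∑ (λ y → ∑ λ x → ∑ λ z → F x y z)  ≡⟨ ∑-cong (λ y → ∑-swap λ x z → F x y z) ⟩
        ∑ (λ y → ∑ (G y))                  ∎

      -- The line has ℓ points because `a` and `b` cannot both vanish when a² + b² = -1.
      line : ∑ (λ y → ∑ λ z → ⟦ m y z ⟧) ≡ ℓ
      line = trans (∑-cong λ y → ∑-cong λ z → cong (λ e → ⟦ a ℤ.* y ℤ.+ e ⟧) (sym (ℤ.+-identityʳ (b ℤ.* z)))) (go (Z? a) (Z? b))
        where
        ℓ∑ : ℓ ℕ.* ∑ ⟦_⟧ ≡ ℓ
        ℓ∑ = trans (cong (ℓ ℕ.*_) ∑⟦⟧) (ℕ.*-identityʳ ℓ)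
        ext : ∀ a b → (a ℤ.* a ℤ.+ b ℤ.* b ℤ.+ 1ℤ) ℤ.+ ℤ.- (a ℤ.* a ℤ.+ b ℤ.* b) ≡ 1ℤ
        ext = solve-∀
        go : Dec (Z a) → Dec (Z b) → ∑ (λ y → ∑ λ z → ⟦ a ℤ.* y ℤ.+ (b ℤ.* z ℤ.+ 0ℤ) ⟧) ≡ ℓ
        go (no ¬a) _       = trans (∑∑-affineˡ ⟦⟧-periodic a b 0ℤ ¬a) ℓ∑
        go (yes _) (no ¬b) = trans (∑∑-affineʳ ⟦⟧-periodic a b 0ℤ ¬b) ℓ∑
        go (yes p) (yes q) = ⊥-elim (¬Z-1 (subst Z (ext a b)
          (Z-+ a²+b²≡-1 (Z-neg (Z-+ (Z-*ʳ a p) (Z-*ʳ b q))))))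

      -- As (ay + bz)(ay - bz) = a²y² - b²z², adding b²(y² + z²) gives (a² + b²)y² = -y². If ay + bz
      -- and y² + z² vanish, so does y; likewise z.
      solve-y² : ∀ a b y z → (a ℤ.* a ℤ.+ b ℤ.* b ℤ.+ 1ℤ) ℤ.* (y ℤ.* y)
        ℤ.+ ℤ.- ((a ℤ.* y ℤ.+ b ℤ.* z) ℤ.* (a ℤ.* y ℤ.- b ℤ.* z) ℤ.+ (y ℤ.* y ℤ.+ z ℤ.* z) ℤ.* (b ℤ.* b)) ≡ y ℤ.* y
      solve-y² = solve-∀
      solve-z² : ∀ a b y z → (a ℤ.* a ℤ.+ b ℤ.* b ℤ.+ 1ℤ) ℤ.* (z ℤ.* z)
        ℤ.+ ℤ.- ((a ℤ.* y ℤ.+ b ℤ.* z) ℤ.* (b ℤ.* z ℤ.- a ℤ.* y) ℤ.+ (y ℤ.* y ℤ.+ z ℤ.* z) ℤ.* (a ℤ.* a)) ≡ z ℤ.* z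
      solve-z² = solve-∀

      ⟦y²+z²⟧ : ∀ {y z} → Z (m y z) → ⟦ y ℤ.* y ℤ.+ z ℤ.* z ⟧ ≡ ⟦ y ⟧ ℕ.* ⟦ z ⟧
      ⟦y²+z²⟧ {y} {z} p = ⟦⟧≡⟦⟧⟦⟧
        (λ q → Z-sq y (subst Z (solve-y² a b y z) (Z-+ (Z-*ʳ (y ℤ.* y) a²+b²≡-1) (Z-neg (Z-+ (Z-*ʳ _ p) (Z-*ʳ _ q)))))
             , Z-sq z (subst Z (solve-z² a b y z) (Z-+ (Z-*ʳ (z ℤ.* z) a²+b²≡-1) (Z-neg (Z-+ (Z-*ʳ _ p) (Z-*ʳ _ q))))))
        (λ q r → Z-+ (Z-*ʳ y q) (Z-*ʳ z r))

      G-value : ∀ y z → G y z ℕ.+ ⟦ m y z ⟧ ≡ 1 ℕ.+ ⟦ y ⟧ ℕ.* ⟦ z ⟧ ℕ.* ℓ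
      G-value y z with Z? (m y z)
      ... | no ¬p rewrite ⟦⟧⟦⟧≡0 {y} {z} (λ (p , q) → ¬p (Z-+ (Z-*ˡ a p) (Z-*ˡ b q))) =
        trans (ℕ.+-identityʳ _) (∑⟦affine⟧ (¬Z-m+m ¬p) _)
      ... | yes p = trans (ℕ.+-comm _ 1) (cong suc (begin
        G y z                        ≡⟨ ∑-cong (λ x → ⟦⟧-periodic _ _ (subst Z (cancel (m y z) x (y ℤ.* y ℤ.+ z ℤ.* z)) (Z-*ʳ x (Z-+ p p)))) ⟩
        ∑ (λ _ → ⟦ y ℤ.* y ℤ.+ z ℤ.* z ⟧)  ≡⟨ ∑-const _ ⟩
        ℓ ℕ.* ⟦ y ℤ.* y ℤ.+ z ℤ.* z ⟧  ≡⟨ trans (ℕ.*-comm ℓ _) (cong (ℕ._* ℓ) (⟦y²+z²⟧ p)) ⟩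
        ⟦ y ⟧ ℕ.* ⟦ z ⟧ ℕ.* ℓ        ∎))
        where
        cancel : ∀ m x s → (m ℤ.+ m) ℤ.* x ≡ ((m ℤ.+ m) ℤ.* x ℤ.+ s) ℤ.- s
        cancel = solve-∀

  -- Translating y by ix turns x² + y² into 2iyx + y². Each y ≠ 0 allows one `x` and y = 0 allows
  -- all ℓ, which makes (ℓ - 1) + ℓ zeros.
  two-squares-split : ∀ i → Z (i ℤ.* i ℤ.+ 1ℤ) → count 2 ⟦_⟧ 0ℤ ℕ.+ 1 ≡ ℓ ℕ.+ ℓ
  two-squares-split i i²≡-1 = begin
    count 2 ⟦_⟧ 0ℤ ℕ.+ 1                     ≡⟨ cong₂ ℕ._+_ reorder (sym ∑⟦⟧) ⟩
    ∑ G ℕ.+ ∑ ⟦_⟧                            ≡⟨ sym (∑-+ G ⟦_⟧) ⟩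
    ∑ (λ y → G y ℕ.+ ⟦ y ⟧)                  ≡⟨ ∑-cong G-value ⟩
    ∑ (λ y → 1 ℕ.+ ⟦ y ⟧ ℕ.* ℓ)              ≡⟨ ∑-+ (λ _ → 1) (λ y → ⟦ y ⟧ ℕ.* ℓ) ⟩
    ∑ (λ _ → 1) ℕ.+ ∑ (λ y → ⟦ y ⟧ ℕ.* ℓ)
      ≡⟨ cong₂ ℕ._+_ (trans (∑-const 1) (ℕ.*-identityʳ ℓ))
           (trans (∑-*ʳ ⟦_⟧ ℓ) (trans (cong (ℕ._* ℓ) ∑⟦⟧) (ℕ.*-identityˡ ℓ))) ⟩
    ℓ ℕ.+ ℓ                                  ∎
    where
    open ≡-Reasoning
    F : ℤ → ℤ → ℕ
    F x y = ⟦ (i ℤ.* y ℤ.+ i ℤ.* y) ℤ.* x ℤ.+ y ℤ.* y ⟧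
    G : ℤ → ℕ
    G y = ∑ λ x → F x y
    expand : ∀ i x y → (i ℤ.* i ℤ.+ 1ℤ) ℤ.* (x ℤ.* x) ≡
      (0ℤ ℤ.+ x ℤ.* x ℤ.+ (y ℤ.+ i ℤ.* x) ℤ.* (y ℤ.+ i ℤ.* x)) ℤ.- ((i ℤ.* y ℤ.+ i ℤ.* y) ℤ.* x ℤ.+ y ℤ.* y)
    expand = solve-∀
    reorder : count 2 ⟦_⟧ 0ℤ ≡ ∑ G
    reorder = trans
      (∑-cong λ x → trans (∑-square-shift ⟦⟧-periodic (0ℤ ℤ.+ x ℤ.* x) (i ℤ.* x))
        (∑-cong λ y → ⟦⟧-periodic _ _ (subst Z (expand i x y) (Z-*ʳ (x ℤ.* x) i²≡-1))))
      (∑-swap F)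
    ¬Z-i : ¬ Z i
    ¬Z-i p = ¬Z-1 (subst Z (lem i) (Z-+ i²≡-1 (Z-neg (Z-*ʳ i p))))
      where
      lem : ∀ i → (i ℤ.* i ℤ.+ 1ℤ) ℤ.+ ℤ.- (i ℤ.* i) ≡ 1ℤ
      lem = solve-∀
    G-value : ∀ y → G y ℕ.+ ⟦ y ⟧ ≡ 1 ℕ.+ ⟦ y ⟧ ℕ.* ℓ
    G-value y with Z? y
    ... | no ¬y = trans (ℕ.+-identityʳ _) (∑⟦affine⟧ (¬Z-m+m (¬Z-* ¬Z-i ¬y)) _)
    ... | yes p = trans (ℕ.+-comm _ 1) (cong suc (trans
      (∑-cong λ x → ⟦⟧≡1 (Z-+ (Z-*ʳ x (Z-+ (Z-*ˡ i p) (Z-*ˡ i p))) (Z-*ʳ y p)))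
      (trans (∑-const 1) (ℕ.*-comm ℓ 1))))

  two-squares-nonsplit : (∀ i → ¬ Z (i ℤ.* i ℤ.+ 1ℤ)) → count 2 ⟦_⟧ 0ℤ ≡ 1
  two-squares-nonsplit ¬i = trans
    (∑-cong λ x → ∑-cong λ y → trans (⟦x²+y²⟧ x y) (sym (ℕ.*-identityʳ _)))
    (∑∑⟦⟧⟦⟧* 1)
    where
    quotient : ∀ x y c → (0ℤ ℤ.+ x ℤ.* x ℤ.+ y ℤ.* y) ℤ.* (c ℤ.* c)
      ℤ.+ ℤ.- ((y ℤ.* c ℤ.- 1ℤ) ℤ.* (y ℤ.* c ℤ.+ 1ℤ)) ≡ (x ℤ.* c) ℤ.* (x ℤ.* c) ℤ.+ 1ℤ
    quotient = solve-∀
    x²-only : ∀ x y → (0ℤ ℤ.+ x ℤ.* x ℤ.+ y ℤ.* y) ℤ.+ ℤ.- (y ℤ.* y) ≡ x ℤ.* x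
    x²-only = solve-∀
    ⟦x²+y²⟧ : ∀ x y → ⟦ 0ℤ ℤ.+ x ℤ.* x ℤ.+ y ℤ.* y ⟧ ≡ ⟦ x ⟧ ℕ.* ⟦ y ⟧
    ⟦x²+y²⟧ x y = ⟦⟧≡⟦⟧⟦⟧
      (λ p → go p (Z? y))
      (λ p q → Z-+ (Z-+ Z-0 (Z-*ʳ x p)) (Z-*ʳ y q))
      where
      -- A zero with y ≠ 0 would make x/y a square root of -1.
      go : Z (0ℤ ℤ.+ x ℤ.* x ℤ.+ y ℤ.* y) → Dec (Z y) → Z x × Z y
      go p (yes q) = Z-sq x (subst Z (x²-only x y) (Z-+ p (Z-neg (Z-*ʳ y q)))) , q
      go p (no ¬q) = let c , yc≡1 = invert ¬q in
        ⊥-elim (¬i (x ℤ.* c) (subst Z (quotient x y c)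
          (Z-+ (Z-*ʳ (c ℤ.* c) p) (Z-neg (Z-*ʳ (y ℤ.* c ℤ.+ 1ℤ) yc≡1)))))

  -- The residues ±1, ..., ±h and the squareness of -1.

  module Half (h : ℕ) (ℓ≡ : ℓ ≡ suc (h ℕ.+ h)) where

    pos : Fin h → ℤ
    pos j = + suc (toℕ j)

    h<ℓ : h ℕ.< ℓ
    h<ℓ = subst (h ℕ.<_) (sym ℓ≡) (s≤s (ℕ.m≤m+n h h))

    ¬Z-pos : ∀ j → ¬ Z (pos j)
    ¬Z-pos j = ¬Z-small (suc (toℕ j)) (s≤s z≤n) (ℕ.≤-<-trans (Fin.toℕ<n j) h<ℓ)

    ∑-fold : ∀ φ → Periodic φ → ∑ φ ≡ φ 0ℤ ℕ.+ sum {h} (λ j → φ (pos j) ℕ.+ φ (ℤ.- pos j))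
    ∑-fold φ per = begin
      ∑ φ                                      ≡⟨ ∑-def φ ⟩
      sum {ℓ} (λ i → φ (+ toℕ i))              ≡⟨ cong (λ n → sum {n} (λ i → φ (+ toℕ i))) ℓ≡ ⟩
      φ 0ℤ ℕ.+ sum {h ℕ.+ h} (λ i → ψ (toℕ i))  ≡⟨ cong (φ 0ℤ ℕ.+_) (sum-splitAt h h ψ) ⟩
      φ 0ℤ ℕ.+ (sum {h} (ψ ∘ toℕ) ℕ.+ sum {h} (λ j → ψ (h ℕ.+ toℕ j)))
        ≡⟨ cong (λ e → φ 0ℤ ℕ.+ (sum {h} (ψ ∘ toℕ) ℕ.+ e)) reflect ⟩
      φ 0ℤ ℕ.+ (sum {h} (λ j → φ (pos j)) ℕ.+ sum {h} (λ j → φ (ℤ.- pos j)))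
        ≡⟨ cong (φ 0ℤ ℕ.+_) (sym (∑-distrib-+ {h} (λ j → φ (pos j)) (λ j → φ (ℤ.- pos j)))) ⟩
      φ 0ℤ ℕ.+ sum {h} (λ j → φ (pos j) ℕ.+ φ (ℤ.- pos j)) ∎
      where
      open ≡-Reasoning
      ψ : ℕ → ℕ
      ψ n = φ (+ suc n)
      -- Read backwards, the upper half h + 1, ..., 2h consists of the numbers ℓ - (j + 1),
      -- congruent to `- pos j`.
      mirror : ∀ j → suc (h ℕ.+ toℕ (opposite j)) ℕ.+ suc (toℕ j) ≡ ℓ
      mirror j = trans (cong suc (trans (ℕ.+-assoc h _ _) (cong (h ℕ.+_)
        (trans (cong (ℕ._+ suc (toℕ j)) (Fin.opposite-prop j)) (ℕ.m∸n+n≡m (Fin.toℕ<n j)))))) (sym ℓ≡)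
      reflect : sum {h} (λ j → ψ (h ℕ.+ toℕ j)) ≡ sum {h} (λ j → φ (ℤ.- pos j))
      reflect = trans (sum-permute {h} {h} (λ j → ψ (h ℕ.+ toℕ j)) reverse)
        (sum-cong-≗ {h} {λ j → ψ (h ℕ.+ toℕ (opposite j))} {λ j → φ (ℤ.- pos j)}
          λ j → per (+ suc (h ℕ.+ toℕ (opposite j))) (ℤ.- pos j) (subst (λ n → Z (+ n)) (sym (mirror j)) Z-ℓ))

    ∑-square-roots : ∀ s → ¬ Z s → ∑ (λ x → ⟦ x ℤ.* x ℤ.- s ℤ.* s ⟧) ≡ 2
    ∑-square-roots s ¬s = begin
      ∑ (λ x → ⟦ x ℤ.* x ℤ.- s ℤ.* s ⟧)                    ≡⟨ ∑-cong factor ⟩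
      ∑ (λ x → ⟦ x ℤ.+ ℤ.- s ⟧ ℕ.+ ⟦ x ℤ.+ s ⟧)            ≡⟨ ∑-+ (λ x → ⟦ x ℤ.+ ℤ.- s ⟧) (λ x → ⟦ x ℤ.+ s ⟧) ⟩
      ∑ (λ x → ⟦ x ℤ.+ ℤ.- s ⟧) ℕ.+ ∑ (λ x → ⟦ x ℤ.+ s ⟧)
        ≡⟨ cong₂ ℕ._+_ (trans (∑-shift ⟦⟧-periodic (ℤ.- s)) ∑⟦⟧) (trans (∑-shift ⟦⟧-periodic s) ∑⟦⟧) ⟩
      2 ∎
      where
      open ≡-Reasoning
      lem : ∀ x s → (x ℤ.+ ℤ.- s) ℤ.* (x ℤ.+ s) ≡ x ℤ.* x ℤ.- s ℤ.* s
      lem = solve-∀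
      diff : ∀ x s → (x ℤ.+ s) ℤ.+ ℤ.- (x ℤ.+ ℤ.- s) ≡ s ℤ.+ s
      diff = solve-∀
      factor : ∀ x → ⟦ x ℤ.* x ℤ.- s ℤ.* s ⟧ ≡ ⟦ x ℤ.+ ℤ.- s ⟧ ℕ.+ ⟦ x ℤ.+ s ⟧
      factor x with Z? (x ℤ.+ ℤ.- s) | Z? (x ℤ.+ s)
      ... | yes p | yes q = ⊥-elim (¬Z-m+m ¬s (subst Z (diff x s) (Z-+ q (Z-neg p))))
      ... | yes p | no _  = ⟦⟧≡1 (subst Z (lem x s) (Z-*ʳ (x ℤ.+ s) p))
      ... | no _  | yes q = ⟦⟧≡1 (subst Z (lem x s) (Z-*ˡ (x ℤ.+ ℤ.- s) q))
      ... | no ¬p | no ¬q = ⟦⟧≡0 λ r → ¬Z-* ¬p ¬q (subst Z (sym (lem x s)) r)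

    -- The indicator of x² = s² is even and vanishes at 0, so its sum over the half is half of its
    -- full sum 2.
    one-root-in-half : ∀ s → ¬ Z s → sum {h} (λ j → ⟦ pos j ℤ.* pos j ℤ.- s ℤ.* s ⟧) ≡ 1
    one-root-in-half s ¬s = halve (begin
      S ℕ.+ S                                ≡⟨ sym (∑-distrib-+ {h} (φ ∘ pos) (φ ∘ pos)) ⟩
      sum {h} (λ j → φ (pos j) ℕ.+ φ (pos j))
        ≡⟨ sum-cong-≗ {h} (λ j → cong (λ e → φ (pos j) ℕ.+ ⟦ e ℤ.- s ℤ.* s ⟧) (neg-sq (pos j))) ⟩
      sum {h} (λ j → φ (pos j) ℕ.+ φ (ℤ.- pos j))
        ≡⟨ cong (ℕ._+ sum {h} (λ j → φ (pos j) ℕ.+ φ (ℤ.- pos j))) (sym φ0) ⟩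
      φ 0ℤ ℕ.+ sum {h} (λ j → φ (pos j) ℕ.+ φ (ℤ.- pos j))  ≡⟨ sym (∑-fold φ per) ⟩
      ∑ φ                                    ≡⟨ ∑-square-roots s ¬s ⟩
      2                                      ∎)
      where
      open ≡-Reasoning
      φ : ℤ → ℕ
      φ x = ⟦ x ℤ.* x ℤ.- s ℤ.* s ⟧
      S = sum {h} (φ ∘ pos)
      neg-sq : ∀ x → x ℤ.* x ≡ (ℤ.- x) ℤ.* (ℤ.- x)
      neg-sq = solve-∀
      dsq : ∀ x y c → (x ℤ.- y) ℤ.* (x ℤ.+ y) ≡ (x ℤ.* x ℤ.- c) ℤ.- (y ℤ.* y ℤ.- c)
      dsq = solve-∀
      per : Periodic φ
      per x y p = ⟦⟧-periodic (x ℤ.* x ℤ.- s ℤ.* s) (y ℤ.* y ℤ.- s ℤ.* s)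
        (subst Z (dsq x y (s ℤ.* s)) (Z-*ʳ (x ℤ.+ y) p))
      neg-neg : ∀ c → ℤ.- (0ℤ ℤ.* 0ℤ ℤ.- c) ≡ c
      neg-neg = solve-∀
      φ0 : φ 0ℤ ≡ 0
      φ0 = ⟦⟧≡0 λ p → ¬Z-* ¬s ¬s (subst Z (neg-neg (s ℤ.* s)) (Z-neg p))
      halve : ∀ {n} → n ℕ.+ n ≡ 2 → n ≡ 1
      halve {suc zero} _ = refl
      halve {suc (suc n)} eq with () ← ℕ.suc-injective (trans (sym (ℕ.+-suc (suc n) (suc n))) (ℕ.suc-injective eq))

    -- Modulo 2, the symmetric relation x y ≡ ±1 on {1,…,h} has as many pairs as diagonal
    -- pairs; each row has one, and the diagonal consists of 1 and the square root of -1, if any.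
    half-parity : ∃[ k ] h ≡ 1 ℕ.+ sum {h} (λ j → ⟦ pos j ℤ.* pos j ℤ.+ 1ℤ ⟧) ℕ.+ (k ℕ.+ k)
    half-parity = let k , eq = sum-symmetric h M M-sym in k , (begin
      h                                  ≡⟨ sym (trans (sum-const h 1) (ℕ.*-identityʳ h)) ⟩
      sum {h} (λ _ → 1)                  ≡⟨ sum-cong-≗ {h} (λ i → sym (row i)) ⟩
      sum {h} (λ i → sum (M i))          ≡⟨ eq ⟩
      sum {h} (λ i → M i i) ℕ.+ (k ℕ.+ k)  ≡⟨ cong (ℕ._+ (k ℕ.+ k)) (∑-distrib-+ {h} (λ i → ⟦ pos i ℤ.* pos i ℤ.- 1ℤ ⟧) _) ⟩
      sum {h} (λ i → ⟦ pos i ℤ.* pos i ℤ.- 1ℤ ⟧) ℕ.+ sum {h} (λ i → ⟦ pos i ℤ.* pos i ℤ.+ 1ℤ ⟧) ℕ.+ (k ℕ.+ k)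
        ≡⟨ cong (λ e → e ℕ.+ sum {h} (λ i → ⟦ pos i ℤ.* pos i ℤ.+ 1ℤ ⟧) ℕ.+ (k ℕ.+ k)) (one-root-in-half 1ℤ ¬Z-1) ⟩
      1 ℕ.+ sum {h} (λ i → ⟦ pos i ℤ.* pos i ℤ.+ 1ℤ ⟧) ℕ.+ (k ℕ.+ k) ∎)
      where
      open ≡-Reasoning
      M : Fin h → Fin h → ℕ
      M i j = ⟦ pos i ℤ.* pos j ℤ.- 1ℤ ⟧ ℕ.+ ⟦ pos i ℤ.* pos j ℤ.+ 1ℤ ⟧
      M-sym : ∀ i j → M i j ≡ M j i
      M-sym i j = cong (λ e → ⟦ e ℤ.- 1ℤ ⟧ ℕ.+ ⟦ e ℤ.+ 1ℤ ⟧) (ℤ.*-comm (pos i) (pos j))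
      -- The equation `pos i * y = 1` has one solution modulo ℓ. Folding `y` with `- y` places it at
      -- exactly one `j` of the half.
      row : ∀ i → sum (M i) ≡ 1
      row i = begin
        sum {h} (M i)
          ≡⟨ sum-cong-≗ {h} {M i} {λ j → φ (pos j) ℕ.+ φ (ℤ.- pos j)} (λ j → cong (φ (pos j) ℕ.+_)
               (⟦⟧-cong (λ p → subst Z (neg₁ (pos i) (pos j)) (Z-neg p))
                        (λ p → subst Z (neg₂ (pos i) (pos j)) (Z-neg p)))) ⟩
        sum {h} (λ j → φ (pos j) ℕ.+ φ (ℤ.- pos j))
          ≡⟨ cong (ℕ._+ sum {h} (λ j → φ (pos j) ℕ.+ φ (ℤ.- pos j))) (sym φ0) ⟩
        φ 0ℤ ℕ.+ sum {h} (λ j → φ (pos j) ℕ.+ φ (ℤ.- pos j))  ≡⟨ sym (∑-fold φ per) ⟩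
        ∑ φ                            ≡⟨ ∑⟦affine⟧ (¬Z-pos i) (ℤ.- 1ℤ) ⟩
        1                              ∎
        where
        φ : ℤ → ℕ
        φ y = ⟦ pos i ℤ.* y ℤ.- 1ℤ ⟧
        neg₁ : ∀ x y → ℤ.- (x ℤ.* y ℤ.+ 1ℤ) ≡ x ℤ.* (ℤ.- y) ℤ.- 1ℤ
        neg₁ = solve-∀
        neg₂ : ∀ x y → ℤ.- (x ℤ.* (ℤ.- y) ℤ.- 1ℤ) ≡ x ℤ.* y ℤ.+ 1ℤ
        neg₂ = solve-∀
        neg₃ : ∀ x → ℤ.- (x ℤ.* 0ℤ ℤ.- 1ℤ) ≡ 1ℤ
        neg₃ = solve-∀
        diff : ∀ c x y → c ℤ.* (x ℤ.- y) ≡ (c ℤ.* x ℤ.- 1ℤ) ℤ.- (c ℤ.* y ℤ.- 1ℤ)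
        diff = solve-∀
        φ0 : φ 0ℤ ≡ 0
        φ0 = ⟦⟧≡0 λ p → ¬Z-1 (subst Z (neg₃ (pos i)) (Z-neg p))
        per : Periodic φ
        per x y p = ⟦⟧-periodic (pos i ℤ.* x ℤ.- 1ℤ) (pos i ℤ.* y ℤ.- 1ℤ)
          (subst Z (diff (pos i) x y) (Z-*ˡ (pos i) p))

    -- If i² = -1, then x² + 1 and x² - i² vanish together, so the half contains exactly one root of
    -- -1. The diagonal then contributes 1 + 1 to `half-parity`.
    -1-square⇒h-even : ∀ i → Z (i ℤ.* i ℤ.+ 1ℤ) → ∃[ k ] h ≡ k ℕ.+ k
    -1-square⇒h-even i i²≡-1 = let k , eq = half-parity in suc k ,
      trans eq (trans (cong (λ e → 1 ℕ.+ e ℕ.+ (k ℕ.+ k)) root) (cong suc (sym (ℕ.+-suc k k))))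
      where
      neg : ∀ i → (i ℤ.* i ℤ.+ 1ℤ) ℤ.+ ℤ.- (i ℤ.* i) ≡ 1ℤ
      neg = solve-∀
      diff : ∀ x i → (i ℤ.* i ℤ.+ 1ℤ) ≡ (x ℤ.* x ℤ.+ 1ℤ) ℤ.- (x ℤ.* x ℤ.- i ℤ.* i)
      diff = solve-∀
      root : sum {h} (λ j → ⟦ pos j ℤ.* pos j ℤ.+ 1ℤ ⟧) ≡ 1
      root = trans
        (sum-cong-≗ {h} λ j → ⟦⟧-periodic (pos j ℤ.* pos j ℤ.+ 1ℤ) (pos j ℤ.* pos j ℤ.- i ℤ.* i)
          (subst Z (diff (pos j) i) i²≡-1))
        (one-root-in-half i λ p → ¬Z-1 (subst Z (neg i) (Z-+ i²≡-1 (Z-neg (Z-*ʳ i p)))))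

    -1-nonsquare⇒h-odd : (∀ i → ¬ Z (i ℤ.* i ℤ.+ 1ℤ)) → ∃[ k ] h ≡ suc (k ℕ.+ k)
    -1-nonsquare⇒h-odd ¬i = let k , eq = half-parity in k ,
      trans eq (cong (λ e → 1 ℕ.+ e ℕ.+ (k ℕ.+ k)) (sum-≡0 {h} λ j → ⟦⟧≡0 (¬i (pos j))))

    -1-square? : (∃[ i ] Z (i ℤ.* i ℤ.+ 1ℤ)) ⊎ (∀ i → ¬ Z (i ℤ.* i ℤ.+ 1ℤ))
    -1-square? with Fin.any? (λ (i : Fin ℓ) → Z? (+ toℕ i ℤ.* + toℕ i ℤ.+ 1ℤ))
    ... | yes (i , p) = inj₁ (+ toℕ i , p)
    ... | no ¬p = inj₂ λ i q → ¬p (residue i ,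
      Z-resp (i ℤ.* i ℤ.+ 1ℤ) (+ toℕ (residue i) ℤ.* + toℕ (residue i) ℤ.+ 1ℤ)
        (subst Z (diff i (+ toℕ (residue i))) (Z-*ʳ (i ℤ.+ + toℕ (residue i)) (Z-residue i))) q)
      where
      diff : ∀ x y → (x ℤ.- y) ℤ.* (x ℤ.+ y) ≡ (x ℤ.* x ℤ.+ 1ℤ) ℤ.- (y ℤ.* y ℤ.+ 1ℤ)
      diff = solve-∀

    difference-of-squares : ∀ x y → x ℤ.* x ℤ.- y ℤ.* y ≡ (x ℤ.- y) ℤ.* (x ℤ.+ y)
    difference-of-squares = solve-∀

    -- The hypotheses force both numbers to be 0. The conclusion has the form that
    -- `square-injective` needs in the case i = -j.
    Z-small-sum : ∀ m n → m ℕ.+ n ℕ.< ℓ → Z (+ (m ℕ.+ n)) → m ≡ n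
    Z-small-sum zero    zero    _ _ = refl
    Z-small-sum zero    (suc n) m+n<ℓ p = ⊥-elim (¬Z-small (suc n) (s≤s z≤n) m+n<ℓ p)
    Z-small-sum (suc m) n       m+n<ℓ p = ⊥-elim (¬Z-small (suc m ℕ.+ n) (s≤s z≤n) m+n<ℓ p)

    square-injective : ∀ (i j : Fin (suc h)) →
      Z (+ toℕ i ℤ.* + toℕ i ℤ.- + toℕ j ℤ.* + toℕ j) → i ≡ j
    square-injective i j p = [ (λ q → Fin.toℕ-injective (residue-unique
        (ℕ.≤-<-trans (Fin.toℕ≤pred[n] i) h<ℓ) (ℕ.≤-<-trans (Fin.toℕ≤pred[n] j) h<ℓ) q))
      , (λ q → Fin.toℕ-injective (Z-small-sum (toℕ i) (toℕ j)
          (subst (toℕ i ℕ.+ toℕ j ℕ.<_) (sym ℓ≡)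
            (s≤s (ℕ.+-mono-≤ (Fin.toℕ≤pred[n] i) (Fin.toℕ≤pred[n] j)))) q))
      ]′ (Z-*⁻ (+ toℕ i ℤ.- + toℕ j) (+ toℕ i ℤ.+ + toℕ j)
           (subst Z (difference-of-squares (+ toℕ i) (+ toℕ j)) p))

    -- The h+1 squares and the h+1 values -1 - y² cannot be distinct among ℓ = 2h+1 residues.
    -1-sum-of-squares : ∃[ a ] ∃[ b ] Z (a ℤ.* a ℤ.+ b ℤ.* b ℤ.+ 1ℤ)
    -1-sum-of-squares = let i , j , i<j , eq = Fin.pigeonhole ℓ<2h+2 (residue ∘ f ∘ splitAt (suc h)) in
      collide (splitAt (suc h) i) (splitAt (suc h) j)
        (λ same → Fin.<⇒≢ i<j (trans (sym (Fin.join-splitAt (suc h) (suc h) i))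
          (trans (cong (join (suc h) (suc h)) same) (Fin.join-splitAt (suc h) (suc h) j))))
        (residue-injective (f (splitAt (suc h) i)) (f (splitAt (suc h) j)) eq)
      where
      f : Fin (suc h) ⊎ Fin (suc h) → ℤ
      f (inj₁ x) = + toℕ x ℤ.* + toℕ x
      f (inj₂ y) = -1ℤ ℤ.- + toℕ y ℤ.* + toℕ y
      ℓ<2h+2 : ℓ ℕ.< suc h ℕ.+ suc h
      ℓ<2h+2 = subst (ℕ._< suc h ℕ.+ suc h) (sym ℓ≡) (s≤s (ℕ.≤-reflexive (sym (ℕ.+-suc h h))))
      neg : ∀ x y → ℤ.- ((-1ℤ ℤ.- x) ℤ.- (-1ℤ ℤ.- y)) ≡ x ℤ.- y
      neg = solve-∀
      move₁ : ∀ x y → x ℤ.- (-1ℤ ℤ.- y) ≡ x ℤ.+ y ℤ.+ 1ℤ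
      move₁ = solve-∀
      move₂ : ∀ x y → ℤ.- ((-1ℤ ℤ.- x) ℤ.- y) ≡ x ℤ.+ y ℤ.+ 1ℤ
      move₂ = solve-∀
      collide : ∀ u v → u ≢ v → Z (f u ℤ.- f v) → ∃[ a ] ∃[ b ] Z (a ℤ.* a ℤ.+ b ℤ.* b ℤ.+ 1ℤ)
      collide (inj₁ x) (inj₁ y) u≢v p = ⊥-elim (u≢v (cong inj₁ (square-injective x y p)))
      collide (inj₁ x) (inj₂ y) u≢v p = + toℕ x , + toℕ y , subst Z (move₁ (+ toℕ x ℤ.* + toℕ x) _) p
      collide (inj₂ x) (inj₁ y) u≢v p = + toℕ x , + toℕ y , subst Z (move₂ (+ toℕ x ℤ.* + toℕ x) _) (Z-neg p)
      collide (inj₂ x) (inj₂ y) u≢v p = ⊥-elim (u≢v (cong inj₂ (square-injective x y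
        (subst Z (neg (+ toℕ x ℤ.* + toℕ x) (+ toℕ y ℤ.* + toℕ y)) (Z-neg p)))))

    -- Closed formulas for the number of zeros.

    count-step : ∀ t → count (4 ℕ.+ t) ⟦_⟧ 0ℤ ℕ.+ ℓ ℕ.* ℓ ^ t
                     ≡ ℓ ℕ.* (ℓ ℕ.* count t ⟦_⟧ 0ℤ) ℕ.+ ℓ ℕ.* (ℓ ℕ.* (ℓ ℕ.* ℓ ^ t))
    count-step t = let a , b , p = -1-sum-of-squares in
      subst (λ T → count (4 ℕ.+ t) ⟦_⟧ 0ℤ ℕ.+ ℓ ℕ.* T
                 ≡ ℓ ℕ.* (ℓ ℕ.* count t ⟦_⟧ 0ℤ) ℕ.+ ℓ ℕ.* (ℓ ℕ.* (ℓ ℕ.* T)))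
        (trans (∑-count t ⟦⟧-periodic) (trans (cong (ℓ ^ t ℕ.*_) ∑⟦⟧) (ℕ.*-identityʳ (ℓ ^ t))))
        -- By definition `count (4 + t) ⟦_⟧` is `count 4` with weight `count t ⟦_⟧`, so the
        -- four-square identity applies to all remaining variables at once.
        (Isotropic.four-squares a b p (count-periodic t ⟦⟧-periodic))

    -- A step of four needs the two starting values t = 1 and t = 3. If the count for t is ℓ^(t -
    -- 1), the first term ℓ²ℓ^(t - 1) on the right of `count-step` cancels ℓ·ℓᵗ on the left and
    -- leaves ℓ^(t + 3).
    count-odd : ∀ k → count (suc (k ℕ.+ k)) ⟦_⟧ 0ℤ ≡ ℓ ^ (k ℕ.+ k)
    count-odd zero = trans (∑-cong λ x → ⟦⟧-cong
        (λ p → Z-sq x (subst Z (ℤ.+-identityˡ (x ℤ.* x)) p))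
        (λ p → subst Z (sym (ℤ.+-identityˡ (x ℤ.* x))) (Z-*ʳ x p)))
      ∑⟦⟧
    count-odd (suc zero) = let a , b , p = -1-sum-of-squares in
      trans (Isotropic.three-squares a b p) (cong (ℓ ℕ.*_) (sym (ℕ.*-identityʳ ℓ)))
    count-odd (suc (suc k)) = ℕ.+-cancelʳ-≡ (ℓ ℕ.* (ℓ ℕ.* P)) _ _ (begin
      count (suc (suc (suc k) ℕ.+ suc (suc k))) ⟦_⟧ 0ℤ ℕ.+ ℓ ℕ.* (ℓ ℕ.* P)
        ≡⟨ cong (λ n → count (suc n) ⟦_⟧ 0ℤ ℕ.+ ℓ ℕ.* (ℓ ℕ.* P)) (shuffle k) ⟩
      count (4 ℕ.+ suc (k ℕ.+ k)) ⟦_⟧ 0ℤ ℕ.+ ℓ ℕ.* (ℓ ℕ.* P)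
        ≡⟨ count-step (suc (k ℕ.+ k)) ⟩
      ℓ ℕ.* (ℓ ℕ.* count (suc (k ℕ.+ k)) ⟦_⟧ 0ℤ) ℕ.+ ℓ ℕ.* (ℓ ℕ.* (ℓ ℕ.* (ℓ ℕ.* P)))
        ≡⟨ cong (λ e → ℓ ℕ.* (ℓ ℕ.* e) ℕ.+ ℓ ℕ.* (ℓ ℕ.* (ℓ ℕ.* (ℓ ℕ.* P)))) (count-odd k) ⟩
      ℓ ℕ.* (ℓ ℕ.* P) ℕ.+ ℓ ℕ.* (ℓ ℕ.* (ℓ ℕ.* (ℓ ℕ.* P)))
        ≡⟨ ℕ.+-comm (ℓ ℕ.* (ℓ ℕ.* P)) _ ⟩
      ℓ ^ (4 ℕ.+ (k ℕ.+ k)) ℕ.+ ℓ ℕ.* (ℓ ℕ.* P)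
        ≡⟨ cong (λ n → ℓ ^ n ℕ.+ ℓ ℕ.* (ℓ ℕ.* P)) (sym (shuffle k)) ⟩
      ℓ ^ (suc (suc k) ℕ.+ suc (suc k)) ℕ.+ ℓ ℕ.* (ℓ ℕ.* P) ∎)
      where
      open ≡-Reasoning
      P = ℓ ^ (k ℕ.+ k)
      shuffle : ∀ k → suc (suc k) ℕ.+ suc (suc k) ≡ 4 ℕ.+ (k ℕ.+ k)
      shuffle = ℕSolver.solve-∀

    -1^even : ∀ n → -1ℤ ℤ.^ (n ℕ.+ n) ≡ 1ℤ
    -1^even zero    = refl
    -1^even (suc n) rewrite ℕ.+-suc n n | -1^even n = refl

    -- The expected count for t = 2(k + 1), free of division: (k + 1)h is t(ℓ - 1)/4, h + h is ℓ -
    -- 1, and k is t/2 - 1.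
    even-formula : ℕ → ℤ
    even-formula k = + (ℓ ^ suc (k ℕ.+ k)) ℤ.+ -1ℤ ℤ.^ (suc k ℕ.* h) ℤ.* + (h ℕ.+ h) ℤ.* + (ℓ ^ k)

    sign-even : ∀ {n} → (∃[ r ] n ≡ r ℕ.+ r) → -1ℤ ℤ.^ n ≡ 1ℤ
    sign-even (r , refl) = -1^even r

    sign-odd : ∀ {n} → (∃[ r ] n ≡ suc (r ℕ.+ r)) → -1ℤ ℤ.^ n ≡ -1ℤ
    sign-odd (r , refl) = cong (-1ℤ ℤ.*_) (-1^even r)

    pos-ℓ* : ∀ n → + (ℓ ℕ.* n) ≡ (1ℤ ℤ.+ + (h ℕ.+ h)) ℤ.* + n
    pos-ℓ* n = trans (ℤ.pos-* ℓ n) (cong (λ m → + m ℤ.* + n) ℓ≡)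

    count-stepℤ : ∀ t → let L = 1ℤ ℤ.+ + (h ℕ.+ h) in
      + count (4 ℕ.+ t) ⟦_⟧ 0ℤ ≡ L ℤ.* (L ℤ.* + count t ⟦_⟧ 0ℤ) ℤ.+ L ℤ.* (L ℤ.* (L ℤ.* + (ℓ ^ t))) ℤ.- L ℤ.* + (ℓ ^ t)
    count-stepℤ t = begin
      + X                                             ≡⟨ sub (+ X) (+ (ℓ ℕ.* P)) ⟩
      + (X ℕ.+ ℓ ℕ.* P) ℤ.- + (ℓ ℕ.* P)               ≡⟨ cong (λ n → + n ℤ.- + (ℓ ℕ.* P)) (count-step t) ⟩
      + (ℓ ℕ.* (ℓ ℕ.* C)) ℤ.+ + (ℓ ℕ.* (ℓ ℕ.* (ℓ ℕ.* P))) ℤ.- + (ℓ ℕ.* P)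
        ≡⟨ cong₂ ℤ._-_ (cong₂ ℤ._+_
             (trans (pos-ℓ* _) (cong (L ℤ.*_) (pos-ℓ* C)))
             (trans (pos-ℓ* _) (cong (L ℤ.*_) (trans (pos-ℓ* _) (cong (L ℤ.*_) (pos-ℓ* P))))))
             (pos-ℓ* P) ⟩
      L ℤ.* (L ℤ.* + C) ℤ.+ L ℤ.* (L ℤ.* (L ℤ.* + P)) ℤ.- L ℤ.* + P ∎
      where
      open ≡-Reasoning
      L = 1ℤ ℤ.+ + (h ℕ.+ h)
      X = count (4 ℕ.+ t) ⟦_⟧ 0ℤ
      C = count t ⟦_⟧ 0ℤ
      P = ℓ ^ t
      sub : ∀ x y → x ≡ (x ℤ.+ y) ℤ.- y
      sub = solve-∀

    -- For t = 2 the count is 2ℓ - 1 or 1, that is ℓ + (-1)^h (ℓ - 1). For t = 4 the recursion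
    -- starts from the empty sum, with count 1, and the exponent 2h is even. Every further step adds
    -- 2h to the exponent and keeps the sign.
    count-even : ∀ k → + count (suc k ℕ.+ suc k) ⟦_⟧ 0ℤ ≡ even-formula k
    count-even zero = go -1-square?
      where
      open ≡-Reasoning
      D = count 2 ⟦_⟧ 0ℤ
      H = + (h ℕ.+ h)
      1*h : 1 ℕ.* h ≡ h
      1*h = ℕ.*-identityˡ h
      formula : ∀ {ε} → -1ℤ ℤ.^ h ≡ ε → even-formula 0 ≡ (1ℤ ℤ.+ H) ℤ.* 1ℤ ℤ.+ ε ℤ.* H ℤ.* 1ℤ
      formula eq = cong₂ (λ a b → a ℤ.+ b ℤ.* H ℤ.* 1ℤ) (pos-ℓ* 1)
        (trans (cong (-1ℤ ℤ.^_) 1*h) eq)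
      lem₁ : ∀ H → ((1ℤ ℤ.+ H) ℤ.+ (1ℤ ℤ.+ H)) ℤ.- 1ℤ ≡ (1ℤ ℤ.+ H) ℤ.* 1ℤ ℤ.+ 1ℤ ℤ.* H ℤ.* 1ℤ
      lem₁ = solve-∀
      lem₂ : ∀ H → 1ℤ ≡ (1ℤ ℤ.+ H) ℤ.* 1ℤ ℤ.+ -1ℤ ℤ.* H ℤ.* 1ℤ
      lem₂ = solve-∀
      sub : ∀ x → x ≡ (x ℤ.+ 1ℤ) ℤ.- 1ℤ
      sub = solve-∀
      go : (∃[ i ] Z (i ℤ.* i ℤ.+ 1ℤ)) ⊎ (∀ i → ¬ Z (i ℤ.* i ℤ.+ 1ℤ)) → + D ≡ even-formula 0
      go (inj₁ (i , p)) = begin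
        + D                            ≡⟨ sub (+ D) ⟩
        + (D ℕ.+ 1) ℤ.- 1ℤ             ≡⟨ cong (λ n → + n ℤ.- 1ℤ) (two-squares-split i p) ⟩
        (+ ℓ ℤ.+ + ℓ) ℤ.- 1ℤ           ≡⟨ cong (λ n → (+ n ℤ.+ + n) ℤ.- 1ℤ) ℓ≡ ⟩
        ((1ℤ ℤ.+ H) ℤ.+ (1ℤ ℤ.+ H)) ℤ.- 1ℤ  ≡⟨ lem₁ H ⟩
        (1ℤ ℤ.+ H) ℤ.* 1ℤ ℤ.+ 1ℤ ℤ.* H ℤ.* 1ℤ  ≡⟨ sym (formula (sign-even (-1-square⇒h-even i p))) ⟩
        even-formula 0                 ∎
      go (inj₂ ¬i) = begin
        + D                            ≡⟨ cong +_ (two-squares-nonsplit ¬i) ⟩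
        1ℤ                             ≡⟨ lem₂ H ⟩
        (1ℤ ℤ.+ H) ℤ.* 1ℤ ℤ.+ -1ℤ ℤ.* H ℤ.* 1ℤ  ≡⟨ sym (formula (sign-odd (-1-nonsquare⇒h-odd ¬i))) ⟩
        even-formula 0                 ∎
    count-even (suc zero) = begin
      + count 4 ⟦_⟧ 0ℤ                 ≡⟨ count-stepℤ 0 ⟩
      L ℤ.* (L ℤ.* + ⟦ 0ℤ ⟧) ℤ.+ L ℤ.* (L ℤ.* (L ℤ.* 1ℤ)) ℤ.- L ℤ.* 1ℤ
        ≡⟨ cong (λ n → L ℤ.* (L ℤ.* + n) ℤ.+ L ℤ.* (L ℤ.* (L ℤ.* 1ℤ)) ℤ.- L ℤ.* 1ℤ) (⟦⟧≡1 Z-0) ⟩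
      L ℤ.* (L ℤ.* 1ℤ) ℤ.+ L ℤ.* (L ℤ.* (L ℤ.* 1ℤ)) ℤ.- L ℤ.* 1ℤ
        ≡⟨ lem H ⟩
      L ℤ.* (L ℤ.* (L ℤ.* 1ℤ)) ℤ.+ 1ℤ ℤ.* H ℤ.* (L ℤ.* 1ℤ)
        ≡⟨ sym (cong₂ ℤ._+_ (trans (pos-ℓ* _) (cong (L ℤ.*_) (trans (pos-ℓ* _) (cong (L ℤ.*_) (pos-ℓ* 1)))))
             (cong₂ (λ a b → a ℤ.* H ℤ.* b) (sign-even {2 ℕ.* h} (h , cong (h ℕ.+_) (ℕ.+-identityʳ h))) (pos-ℓ* 1))) ⟩
      even-formula 1                   ∎
      where
      open ≡-Reasoning
      H = + (h ℕ.+ h)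
      L = 1ℤ ℤ.+ H
      lem : ∀ H → (1ℤ ℤ.+ H) ℤ.* ((1ℤ ℤ.+ H) ℤ.* 1ℤ) ℤ.+ (1ℤ ℤ.+ H) ℤ.* ((1ℤ ℤ.+ H) ℤ.* ((1ℤ ℤ.+ H) ℤ.* 1ℤ)) ℤ.- (1ℤ ℤ.+ H) ℤ.* 1ℤ
                ≡ (1ℤ ℤ.+ H) ℤ.* ((1ℤ ℤ.+ H) ℤ.* ((1ℤ ℤ.+ H) ℤ.* 1ℤ)) ℤ.+ 1ℤ ℤ.* H ℤ.* ((1ℤ ℤ.+ H) ℤ.* 1ℤ)
      lem = solve-∀
    count-even (suc (suc k)) = begin
      + count (3+k ℕ.+ 3+k) ⟦_⟧ 0ℤ
        ≡⟨ cong (λ n → + count n ⟦_⟧ 0ℤ) (shuffle k) ⟩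
      + count (4 ℕ.+ (suc k ℕ.+ suc k)) ⟦_⟧ 0ℤ
        ≡⟨ count-stepℤ (suc k ℕ.+ suc k) ⟩
      L ℤ.* (L ℤ.* + count (suc k ℕ.+ suc k) ⟦_⟧ 0ℤ) ℤ.+ L ℤ.* (L ℤ.* (L ℤ.* + (ℓ ^ (suc k ℕ.+ suc k)))) ℤ.- L ℤ.* + (ℓ ^ (suc k ℕ.+ suc k))
        ≡⟨ cong₂ (λ c p → L ℤ.* (L ℤ.* c) ℤ.+ L ℤ.* (L ℤ.* (L ℤ.* p)) ℤ.- L ℤ.* p) (count-even k) pow₂ ⟩
      L ℤ.* (L ℤ.* (P ℤ.+ ε ℤ.* H ℤ.* Q)) ℤ.+ L ℤ.* (L ℤ.* (L ℤ.* (L ℤ.* P))) ℤ.- L ℤ.* (L ℤ.* P)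
        ≡⟨ lem H P ε Q ⟩
      L ℤ.* (L ℤ.* (L ℤ.* (L ℤ.* P))) ℤ.+ ε ℤ.* H ℤ.* (L ℤ.* (L ℤ.* Q))
        ≡⟨ sym (cong₂ ℤ._+_ pow₅ (cong₂ (λ a b → a ℤ.* H ℤ.* b) sign (trans (pos-ℓ* _) (cong (L ℤ.*_) (pos-ℓ* (ℓ ^ k)))))) ⟩
      even-formula (suc (suc k)) ∎
      where
      open ≡-Reasoning
      3+k = suc (suc (suc k))
      H = + (h ℕ.+ h)
      L = 1ℤ ℤ.+ H
      P = + (ℓ ^ suc (k ℕ.+ k))
      Q = + (ℓ ^ k)
      ε = -1ℤ ℤ.^ (suc k ℕ.* h)
      shuffle : ∀ k → suc (suc (suc k)) ℕ.+ suc (suc (suc k)) ≡ 4 ℕ.+ (suc k ℕ.+ suc k)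
      shuffle = ℕSolver.solve-∀
      shuffle₂ : ∀ k → suc k ℕ.+ suc k ≡ suc (suc (k ℕ.+ k))
      shuffle₂ = ℕSolver.solve-∀
      shuffle₅ : ∀ k → suc (suc (suc k) ℕ.+ suc (suc k)) ≡ 4 ℕ.+ suc (k ℕ.+ k)
      shuffle₅ = ℕSolver.solve-∀
      shuffle-sign : ∀ k h → suc (suc (suc k)) ℕ.* h ≡ suc k ℕ.* h ℕ.+ (h ℕ.+ h)
      shuffle-sign = ℕSolver.solve-∀
      pow₂ : + (ℓ ^ (suc k ℕ.+ suc k)) ≡ L ℤ.* P
      pow₂ = trans (cong (λ n → + (ℓ ^ n)) (shuffle₂ k)) (pos-ℓ* (ℓ ^ suc (k ℕ.+ k)))
      pow₅ : + (ℓ ^ suc (suc (suc k) ℕ.+ suc (suc k))) ≡ L ℤ.* (L ℤ.* (L ℤ.* (L ℤ.* P)))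
      pow₅ = trans (cong (λ n → + (ℓ ^ n)) (shuffle₅ k)) (trans (pos-ℓ* _) (cong (L ℤ.*_)
        (trans (pos-ℓ* _) (cong (L ℤ.*_) (trans (pos-ℓ* _) (cong (L ℤ.*_) (pos-ℓ* (ℓ ^ suc (k ℕ.+ k)))))))))
      sign : -1ℤ ℤ.^ (3+k ℕ.* h) ≡ ε
      sign = trans (cong (-1ℤ ℤ.^_) (shuffle-sign k h)) (trans (ℤ.^-distribˡ-+-* -1ℤ (suc k ℕ.* h) (h ℕ.+ h))
        (trans (cong (ε ℤ.*_) (-1^even h)) (ℤ.*-identityʳ ε)))
      lem : ∀ H P ε Q →
        (1ℤ ℤ.+ H) ℤ.* ((1ℤ ℤ.+ H) ℤ.* (P ℤ.+ ε ℤ.* H ℤ.* Q)) ℤ.+ (1ℤ ℤ.+ H) ℤ.* ((1ℤ ℤ.+ H) ℤ.* ((1ℤ ℤ.+ H) ℤ.* ((1ℤ ℤ.+ H) ℤ.* P))) ℤ.- (1ℤ ℤ.+ H) ℤ.* ((1ℤ ℤ.+ H) ℤ.* P)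
        ≡ (1ℤ ℤ.+ H) ℤ.* ((1ℤ ℤ.+ H) ℤ.* ((1ℤ ℤ.+ H) ℤ.* ((1ℤ ℤ.+ H) ℤ.* P))) ℤ.+ ε ℤ.* H ℤ.* ((1ℤ ℤ.+ H) ℤ.* ((1ℤ ℤ.+ H) ℤ.* Q))
      lem = solve-∀

    zeros-odd : ∀ {t} → ¬ (2 ∣ t) → + count t ⟦_⟧ 0ℤ ≡ + (ℓ ^ (t ∸ 1))
    zeros-odd 2∤t = go (odd⇒half 2∤t)
      where
      go : ∀ {t} → (∃[ k ] t ≡ suc (k ℕ.+ k)) → + count t ⟦_⟧ 0ℤ ≡ + (ℓ ^ (t ∸ 1))
      go (k , refl) = cong +_ (count-odd k)

    zeros-even : ∀ {t} → 2 ≤ t → 2 ∣ t → + count t ⟦_⟧ 0ℤ ≡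
      + (ℓ ^ (t ∸ 1)) ℤ.+ -1ℤ ℤ.^ (t * (ℓ ∸ 1) / 4) ℤ.* + (ℓ ∸ 1) ℤ.* + (ℓ ^ (t / 2 ∸ 1))
    zeros-even 2≤t 2∣t = go 2≤t (even⇒half 2∣t)
      where
      go : ∀ {t} → 2 ≤ t → (∃[ k ] t ≡ k ℕ.+ k) → + count t ⟦_⟧ 0ℤ ≡
        + (ℓ ^ (t ∸ 1)) ℤ.+ -1ℤ ℤ.^ (t * (ℓ ∸ 1) / 4) ℤ.* + (ℓ ∸ 1) ℤ.* + (ℓ ^ (t / 2 ∸ 1))
      go () (zero , refl)
      go _ (suc k , refl) = trans (count-even k)
        (cong₂ ℤ._+_ (cong (λ n → + (ℓ ^ n)) (sym (ℕ.+-suc k k)))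
          (cong₂ ℤ._*_ (cong₂ (λ e n → -1ℤ ℤ.^ e ℤ.* + n) exponent (sym ℓ∸1))
            (cong (λ n → + (ℓ ^ (n ∸ 1))) half)))
        where
        ℓ∸1 : ℓ ∸ 1 ≡ h ℕ.+ h
        ℓ∸1 = cong (_∸ 1) ℓ≡
        double : ∀ k → suc k ℕ.* 2 ≡ suc k ℕ.+ suc k
        double = ℕSolver.solve-∀
        quadruple : ∀ k h → suc k ℕ.* h ℕ.* 4 ≡ (suc k ℕ.+ suc k) ℕ.* (h ℕ.+ h)
        quadruple = ℕSolver.solve-∀
        half : suc k ≡ (suc k ℕ.+ suc k) / 2
        half = trans (sym (m*n/n≡m (suc k) 2)) (cong (_/ 2) (double k))
        -- The division by 4 is exact, since t(ℓ - 1) = 4(k + 1)h.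
        exponent : suc k ℕ.* h ≡ (suc k ℕ.+ suc k) * (ℓ ∸ 1) / 4
        exponent = trans (sym (m*n/n≡m (suc k ℕ.* h) 4))
          (cong (_/ 4) (trans (quadruple k h) (cong ((suc k ℕ.+ suc k) ℕ.*_) (sym ℓ∸1))))

-- Units and the factor T² in power series rings.

module UnitSeries {c r} (R : CommutativeRing c r) where
  open CommutativeRing R hiding (refl; sym; trans) renaming (_*_ to _·_)
  module ≈ = CommutativeRing R using (refl; sym; trans)
  open PowerSeries R
  module Sum = SemiringSum semiring
  open import Relation.Binary.Reasoning.Setoid setoid

  ⊛-comm : ∀ f g → f ⊛ g ≋ g ⊛ f
  ⊛-comm f g n = ≈.trans (Sum.sum-permute {suc n} {suc n} (λ i → f (toℕ i) · g (n ∸ toℕ i)) reverse)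
    (Sum.sum-cong-≋ λ i → ≈.trans (*-comm _ _) (*-cong
      (reflexive (cong g (trans (cong (n ∸_) (Fin.opposite-prop i)) (ℕ.m∸[m∸n]≡n (ℕ.≤-pred (Fin.toℕ<n i))))))
      (reflexive (cong f (Fin.opposite-prop i)))))

  -- Long division of s by u, where c is inverse to the constant term of u.
  quot : Carrier → Series → Series → Series
  quot c u s zero    = c · s 0
  quot c u s (suc n) = quot c u (λ m → s (suc m) - (c · s 0) · u (suc m)) n

  -- The leading term of the quotient contributes `e` to the next coefficient; long division has
  -- subtracted it from the remainder, whose coefficients are shifted by one. Hence the induction on
  -- `n` for all `s` at once.
  quot-⊛ : ∀ c u → c · u 0 ≈ 1# → ∀ s → quot c u s ⊛ u ≋ s
  quot-⊛ c u cu₀≈1 s zero = begin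
    (c · s 0) · u 0 + 0#  ≈⟨ +-identityʳ _ ⟩
    (c · s 0) · u 0       ≈⟨ *-congʳ (*-comm c (s 0)) ⟩
    (s 0 · c) · u 0       ≈⟨ *-assoc (s 0) c (u 0) ⟩
    s 0 · (c · u 0)       ≈⟨ *-congˡ cu₀≈1 ⟩
    s 0 · 1#              ≈⟨ *-identityʳ (s 0) ⟩
    s 0                   ∎
  quot-⊛ c u cu₀≈1 s (suc n) = begin
    e + (quot c u (λ m → s (suc m) - (c · s 0) · u (suc m)) ⊛ u) n  ≈⟨ +-congˡ (quot-⊛ c u cu₀≈1 (λ m → s (suc m) - (c · s 0) · u (suc m)) n) ⟩
    e + (s (suc n) - e)  ≈⟨ +-congˡ (+-comm (s (suc n)) (- e)) ⟩
    e + (- e + s (suc n))  ≈⟨ ≈.sym (+-assoc e (- e) (s (suc n))) ⟩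
    (e - e) + s (suc n)  ≈⟨ +-congʳ (-‿inverseʳ e) ⟩
    0# + s (suc n)       ≈⟨ +-identityˡ _ ⟩
    s (suc n)            ∎
    where e = (c · s 0) · u (suc n)

  unit : ∀ c u → c · u 0 ≈ 1# → IsUnit u
  unit c u cu₀≈1 = v , quot-⊛ c u cu₀≈1 1ˢ ,
    λ n → ≈.trans (⊛-comm u v n) (quot-⊛ c u cu₀≈1 1ˢ n)
    where v = quot c u 1ˢ

  T² : Series
  T² 2 = 1#
  T² _ = 0#

  T²-⊛ : ∀ f → f 0 ≈ 0# → f 1 ≈ 0# → f ≋ T² ⊛ (λ n → f (2 ℕ.+ n))
  T²-⊛ f f₀ f₁ 0 = ≈.trans f₀ (≈.sym (≈.trans (+-identityʳ _) (zeroˡ _)))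
  T²-⊛ f f₀ f₁ 1 = ≈.trans f₁ (≈.sym (≈.trans (+-cong (zeroˡ _) (≈.trans (+-identityʳ _) (zeroˡ _))) (+-identityʳ 0#)))
  T²-⊛ f f₀ f₁ (suc (suc m)) = ≈.sym (begin
    0# · f _ + (0# · f _ + (1# · f (2 ℕ.+ m) + tail))  ≈⟨ +-cong (zeroˡ _) (+-cong (zeroˡ _) (+-cong (*-identityˡ _) tail≈0)) ⟩
    0# + (0# + (f (2 ℕ.+ m) + 0#))                     ≈⟨ ≈.trans (+-identityˡ _) (≈.trans (+-identityˡ _) (+-identityʳ _)) ⟩
    f (2 ℕ.+ m)                                        ∎)
    where
    tail = Sum.sum {m} λ i → 0# · f (2 ℕ.+ (m ∸ suc (toℕ i)))
    tail≈0 : tail ≈ 0#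
    tail≈0 = ≈.trans (Sum.sum-cong-≋ {m} λ i → zeroˡ _) (Sum.sum-replicate-zero m)

  T²-factor : ∀ f c p → f 0 ≈ 0# → f 1 ≈ 0# → c · f 2 ≈ 1# → p ≈ 1# →
    ∃[ u ] IsUnit u × f ≋ p • (T² ⊛ u)
  T²-factor f c p f₀ f₁ cf₂≈1 p≈1 = (λ n → f (2 ℕ.+ n)) , unit c _ cf₂≈1 ,
    λ n → ≈.trans (T²-⊛ f f₀ f₁ n) (≈.sym (≈.trans (*-congʳ p≈1) (*-identityˡ _)))

  T²-vanishing : ∀ {i} → 2 ℕ.< i → T² i ≈ 0#
  T²-vanishing {suc zero}          (s≤s ())
  T²-vanishing {suc (suc zero)}    (s≤s (s≤s ()))
  T²-vanishing {suc (suc (suc i))} _ = ≈.refl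

  T²-divisible : ∀ p {i} → i ℕ.< 2 → ∃[ q ] q · p ≈ T² i
  T²-divisible p {zero}        _ = 0# , zeroˡ p
  T²-divisible p {suc zero}    _ = 0# , zeroˡ p
  T²-divisible p {suc (suc i)} (s≤s (s≤s ()))

sumℤ : ∀ {n} → (Fin n → ℤ) → ℤ
sumℤ = RawMonoidDefs.sum ℤ.+-0-rawMonoid

-- The characteristic series modulo ℓ.

module Characteristic {ℓ : ℕ} (ℓ-prime : Prime ℓ) (ℓ-odd : ¬ (2 ∣ ℓ)) where
  module A = Adic ℓ-prime
  open A using (ℤₗ; mkℤₗ; approx; coherent; at; mk≈; _≡[_]_; fromℤ; binom; fall)
  open Residues ℓ-prime ℓ-odd
  open UnitSeries (Adic.ℤₗ-commutativeRing ℓ-prime)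

  ≡[1]⇒Z : ∀ x y → x ≡[ 1 ] y → Z (x ℤ.- y)
  ≡[1]⇒Z x y = subst (λ n → + n ℤ.∣ (x ℤ.- y)) (ℕ.*-identityʳ ℓ)

  Z⇒≡[1] : ∀ x y → Z (x ℤ.- y) → x ≡[ 1 ] y
  Z⇒≡[1] x y = subst (λ n → + n ℤ.∣ (x ℤ.- y)) (sym (ℕ.*-identityʳ ℓ))

  ∣-1 : ∀ x → 1ℤ ℤ.∣ x
  ∣-1 x = ℤ.divides x (sym (ℤ.*-identityʳ x))

  -- Errors multiply: for z = y + y₁ - xyy₁ one has 1 - xz = (1 - xy)(1 - xy₁), so an inverse modulo
  -- ℓ lifts an inverse modulo ℓᵏ by one level.
  invert-mod : ∀ {x} → ¬ Z x → ∀ k → ∃[ y ] x ℤ.* y ≡[ k ] 1ℤ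
  invert-mod {x} ¬x zero = 0ℤ , ∣-1 (x ℤ.* 0ℤ ℤ.- 1ℤ)
  invert-mod {x} ¬x (suc k) =
    let y₁ , ℤ.divides q₁ eq₁ = invert ¬x
        y , ℤ.divides q eq = invert-mod ¬x k
    in y ℤ.+ y₁ ℤ.- x ℤ.* y ℤ.* y₁ , ℤ.divides (ℤ.- (q₁ ℤ.* q)) (begin
      x ℤ.* (y ℤ.+ y₁ ℤ.- x ℤ.* y ℤ.* y₁) ℤ.- 1ℤ        ≡⟨ lem x y y₁ ⟩
      ℤ.- ((x ℤ.* y₁ ℤ.- 1ℤ) ℤ.* (x ℤ.* y ℤ.- 1ℤ))     ≡⟨ cong₂ (λ a b → ℤ.- (a ℤ.* b)) eq₁ eq ⟩
      ℤ.- ((q₁ ℤ.* + ℓ) ℤ.* (q ℤ.* + (ℓ ^ k)))         ≡⟨ lem₂ q₁ (+ ℓ) q (+ (ℓ ^ k)) ⟩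
      ℤ.- (q₁ ℤ.* q) ℤ.* (+ ℓ ℤ.* + (ℓ ^ k))           ≡⟨ cong (ℤ.- (q₁ ℤ.* q) ℤ.*_) (sym (ℤ.pos-* ℓ (ℓ ^ k))) ⟩
      ℤ.- (q₁ ℤ.* q) ℤ.* + (ℓ ^ suc k)                 ∎)
    where
    open ≡-Reasoning
    lem : ∀ x y z → x ℤ.* (y ℤ.+ z ℤ.- x ℤ.* y ℤ.* z) ℤ.- 1ℤ ≡ ℤ.- ((x ℤ.* z ℤ.- 1ℤ) ℤ.* (x ℤ.* y ℤ.- 1ℤ))
    lem = solve-∀
    lem₂ : ∀ a b c d → ℤ.- ((a ℤ.* b) ℤ.* (c ℤ.* d)) ≡ ℤ.- (a ℤ.* c) ℤ.* (b ℤ.* d)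
    lem₂ = solve-∀

  invertₗ : ∀ a → ¬ Z (approx a 1) → ∃[ c ] c A.* a A.≈ A.1#
  invertₗ a ¬a = mkℤₗ y coh , mk≈ λ k → subst (_≡[ k ] 1ℤ) (ℤ.*-comm (approx a k) (y k)) (spec k)
    where
    inverse : ∀ k → ∃[ y ] approx a k ℤ.* y ≡[ k ] 1ℤ
    -- Modulo ℓ⁰ = 1 nothing is required, and `approx a 0` may well be divisible by ℓ.
    inverse zero    = 0ℤ , ∣-1 (approx a 0 ℤ.* 0ℤ ℤ.- 1ℤ)
    inverse (suc k) = invert-mod (λ p → ¬a (Z-resp (approx a (suc k)) (approx a 1)
      (≡[1]⇒Z (approx a (suc k)) (approx a 1) (A.coherent* a 1 k)) p)) (suc k)
    y : ℕ → ℤ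
    y k = proj₁ (inverse k)
    spec : ∀ k → approx a k ℤ.* y k ≡[ k ] 1ℤ
    spec k = proj₂ (inverse k)
    -- The inverses are chosen separately at each level; they are coherent because an inverse modulo
    -- ℓᵏ is unique. This identity is that uniqueness.
    lem : ∀ a a′ y y′ → ℤ.- ((a ℤ.* y ℤ.- 1ℤ) ℤ.* y′) ℤ.+ (ℤ.- ((a′ ℤ.- a) ℤ.* (y ℤ.* y′)) ℤ.+ (a′ ℤ.* y′ ℤ.- 1ℤ) ℤ.* y)
                      ≡ y′ ℤ.- y
    lem = solve-∀
    coh : ∀ k → y (suc k) ≡[ k ] y k
    coh k = subst (+ (ℓ ^ k) ℤ.∣_) (lem (approx a k) (approx a (suc k)) (y k) (y (suc k)))
      (ℤ.∣m∣n⇒∣m+n (ℤ.∣m⇒∣-m (ℤ.∣m⇒∣m*n (y (suc k)) (spec k)))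
      (ℤ.∣m∣n⇒∣m+n (ℤ.∣m⇒∣-m (ℤ.∣m⇒∣m*n (y k ℤ.* y (suc k)) (coherent a k)))
        (ℤ.∣m⇒∣m*n (y k) (A.≡[]-weaken k 1 (approx a (suc k) ℤ.* y (suc k)) 1ℤ
          (subst (λ n → + (ℓ ^ n) ℤ.∣ (approx a (suc k) ℤ.* y (suc k) ℤ.- 1ℤ)) (sym (ℕ.+-comm k 1)) (spec (suc k)))))))

  approx-sum : ∀ {t} (x : Fin t → ℤₗ) k →
    approx (SemiringSum.sum A.semiring x) k ≡ sumℤ (λ j → approx (x j) k)
  approx-sum {zero}  x k = refl
  approx-sum {suc t} x k = cong (λ e → approx (x zero) k ℤ.+ e) (approx-sum (x ∘ suc) k)

  summand : ℤₗ → A.Series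
  summand b = fromℤ (+ 2) A.• A.1ˢ A.⊕ A.⊖ binom b A.⊕ A.⊖ binom (A.- b)

  private
    -- Dividing by n! costs precision: level k of the quotient is read off at level k + n!. Hence
    -- the levels k + 1 and k + 2 in the coefficients of T and T².
    binom-eq : ∀ b n k → approx (fall b n) (k ℕ.+ n ℕ.!) ≡ approx (binom b n) k ℤ.* + (n ℕ.!)
    binom-eq b n k = ℤ._∣_.equality (A.!∣fallₗ b n (k ℕ.+ n ℕ.!))

  summand-0 : ∀ b k → approx (summand b 0) k ≡ 0ℤ
  summand-0 b k = cong₂ (λ p q → + 2 ℤ.+ ℤ.- p ℤ.+ ℤ.- q) (one b) (one (A.- b))
    where
    one : ∀ b → approx (binom b 0) k ≡ 1ℤ
    one b = trans (sym (ℤ.*-identityʳ _)) (sym (binom-eq b 0 k))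

  summand-1 : ∀ b k → approx (summand b 1) k ≡ 0ℤ
  summand-1 b k = trans (cong₂ (λ p q → 0ℤ ℤ.+ ℤ.- p ℤ.+ ℤ.- q) (lin b) (lin (A.- b))) (lem₂ (approx b (k ℕ.+ 1)))
    where
    lem : ∀ x → 1ℤ ℤ.* (x ℤ.- 0ℤ) ≡ x
    lem = solve-∀
    lem₂ : ∀ x → 0ℤ ℤ.+ ℤ.- x ℤ.+ ℤ.- (ℤ.- x) ≡ 0ℤ
    lem₂ = solve-∀
    lin : ∀ b → approx (binom b 1) k ≡ approx b (k ℕ.+ 1)
    lin b = trans (sym (ℤ.*-identityʳ _)) (trans (sym (binom-eq b 1 k)) (lem (approx b (k ℕ.+ 1))))

  -- The sum of x(x - 1)/2 and (-x)(-x - 1)/2 is x². The comparison is made after doubling, where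
  -- the binomials become falling factorials.
  summand-2 : ∀ b k → approx (summand b 2) k ≡ ℤ.- (approx b (k ℕ.+ 2) ℤ.* approx b (k ℕ.+ 2))
  summand-2 b k = ℤ.*-cancelʳ-≡ _ _ (+ 2) (begin
    (0ℤ ℤ.+ ℤ.- p ℤ.+ ℤ.- q) ℤ.* + 2           ≡⟨ lem p q ⟩
    ℤ.- (p ℤ.* + 2) ℤ.+ ℤ.- (q ℤ.* + 2)        ≡⟨ cong₂ (λ u v → ℤ.- u ℤ.+ ℤ.- v) (sym (binom-eq b 2 k)) (sym (binom-eq (A.- b) 2 k)) ⟩
    ℤ.- (1ℤ ℤ.* (x ℤ.- 0ℤ) ℤ.* (x ℤ.- 1ℤ)) ℤ.+ ℤ.- (1ℤ ℤ.* (ℤ.- x ℤ.- 0ℤ) ℤ.* (ℤ.- x ℤ.- 1ℤ))  ≡⟨ lem₂ x ⟩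
    ℤ.- (x ℤ.* x) ℤ.* + 2                      ∎)
    where
    open ≡-Reasoning
    p = approx (binom b 2) k
    q = approx (binom (A.- b) 2) k
    x = approx b (k ℕ.+ 2)
    lem : ∀ p q → (0ℤ ℤ.+ ℤ.- p ℤ.+ ℤ.- q) ℤ.* (1ℤ ℤ.+ 1ℤ) ≡ ℤ.- (p ℤ.* (1ℤ ℤ.+ 1ℤ)) ℤ.+ ℤ.- (q ℤ.* (1ℤ ℤ.+ 1ℤ))
    lem = solve-∀
    lem₂ : ∀ x → ℤ.- (1ℤ ℤ.* (x ℤ.- 0ℤ) ℤ.* (x ℤ.- 1ℤ)) ℤ.+ ℤ.- (1ℤ ℤ.* (ℤ.- x ℤ.- 0ℤ) ℤ.* (ℤ.- x ℤ.- 1ℤ))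
               ≡ ℤ.- (x ℤ.* x) ℤ.* (1ℤ ℤ.+ 1ℤ)
    lem₂ = solve-∀

  sumℤ-0 : ∀ {t} (x : Fin t → ℤ) → (∀ j → x j ≡ 0ℤ) → sumℤ x ≡ 0ℤ
  sumℤ-0 {zero}  x x≡0 = refl
  sumℤ-0 {suc t} x x≡0 = cong₂ ℤ._+_ (x≡0 zero) (sumℤ-0 (x ∘ suc) (x≡0 ∘ suc))

  charSeries-0 : ∀ {t} (α : Fin t → ℤₗ) → Adic.charSeries ℓ-prime α 0 A.≈ A.0#
  charSeries-0 α = A.pointwise λ k →
    trans (approx-sum (λ j → summand (α j) 0) k) (sumℤ-0 _ λ j → summand-0 (α j) k)

  charSeries-1 : ∀ {t} (α : Fin t → ℤₗ) → Adic.charSeries ℓ-prime α 1 A.≈ A.0#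
  charSeries-1 α = A.pointwise λ k →
    trans (approx-sum (λ j → summand (α j) 1) k) (sumℤ-0 _ λ j → summand-1 (α j) k)

  norm : ∀ {t} → (Fin t → ℤ) → ℤ
  norm x = sumℤ λ j → x j ℤ.* x j

  residues : ∀ {t} → (Fin t → ℤₗ) → Fin t → ℤ
  residues α j = approx (α j) 1

  charSeries-2 : ∀ {t} (α : Fin t → ℤₗ) → Z (approx (Adic.charSeries ℓ-prime α 2) 1 ℤ.+ norm (residues α))
  charSeries-2 α = subst (λ e → Z (e ℤ.+ norm (residues α))) (sym (approx-sum (λ j → summand (α j) 2) 1)) (go α)
    where
    -- The coefficient involves `α j` at level 3, the norm involves it at level 1; coherence makes
    -- the two congruent modulo ℓ.
    lem : ∀ a b x s → (ℤ.- ((x ℤ.- a) ℤ.* (x ℤ.+ a)) ℤ.+ (b ℤ.+ s)) ≡ (ℤ.- (x ℤ.* x) ℤ.+ b) ℤ.+ (a ℤ.* a ℤ.+ s)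
    lem = solve-∀
    go : ∀ {t} (α : Fin t → ℤₗ) → Z (sumℤ (λ j → approx (summand (α j) 2) 1) ℤ.+ norm (residues α))
    go {zero}  α = Z-0
    go {suc t} α = subst (λ e → Z ((e ℤ.+ rest) ℤ.+ (a ℤ.* a ℤ.+ norm (residues (α ∘ suc))))) (sym (summand-2 (α zero) 1))
      (subst Z (lem a rest x (norm (residues (α ∘ suc))))
        (Z-+ (Z-neg (Z-*ʳ (x ℤ.+ a) (≡[1]⇒Z x a (A.coherent* (α zero) 1 2)))) (go (α ∘ suc))))
      where
      a = approx (α zero) 1
      x = approx (α zero) 3
      rest = sumℤ λ j → approx (summand (α (suc j)) 2) 1

  Z-∣ₗ : ∀ {x} → fromℤ (+ ℓ) A.∣ₗ x → Z (approx x 1)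
  Z-∣ₗ {x} (q , eq) = Z-resp (approx q 1 ℤ.* + ℓ) (approx x 1) (≡[1]⇒Z (approx q 1 ℤ.* + ℓ) (approx x 1) (at eq 1))
    (Z-*ˡ (approx q 1) Z-ℓ)

  -- The coefficient of T² in gu is g₀u₂ + g₁u₁ + g₂u₀, which is u₀ modulo ℓ. If ℓ divided the norm,
  -- it would divide u₀, against v₀u₀ = 1.
  invariants⇒norm : ∀ {t} (α : Fin t → ℤₗ) → Adic.HasInvariants ℓ-prime α 0 1 → ¬ Z (norm (residues α))
  invariants⇒norm α (g , u , g-dist , (v , vu≋1 , _) , f≋gu) Z-norm = ¬Z-1 (Z-resp (v0 ℤ.* u0 ℤ.+ 0ℤ) 1ℤ
    (≡[1]⇒Z (v0 ℤ.* u0 ℤ.+ 0ℤ) 1ℤ (at (vu≋1 0) 1)) (Z-+ (Z-*ˡ v0 Z-u0) Z-0))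
    where
    open A.IsDistinguished g-dist
    v0 = approx (v 0) 1
    u0 = approx (u 0) 1
    u1 = approx (u 1) 1
    u2 = approx (u 2) 1
    g0 = approx (g 0) 1
    g1 = approx (g 1) 1
    g2 = approx (g 2) 1
    f2 = approx (Adic.charSeries ℓ-prime α 2) 1
    gu2 = 1ℤ ℤ.* (g0 ℤ.* u2 ℤ.+ (g1 ℤ.* u1 ℤ.+ (g2 ℤ.* u0 ℤ.+ 0ℤ)))
    lem : ∀ f n → (f ℤ.+ n) ℤ.+ ℤ.- n ≡ f
    lem = solve-∀
    Z-f2 : Z f2
    Z-f2 = subst Z (lem f2 (norm (residues α))) (Z-+ (charSeries-2 α) (Z-neg Z-norm))
    Z-gu2 : Z gu2
    Z-gu2 = Z-resp f2 gu2 (≡[1]⇒Z f2 gu2 (at (f≋gu 2) 1)) Z-f2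
    lem₂ : ∀ a b c u → 1ℤ ℤ.* (a ℤ.+ (b ℤ.+ (c ℤ.* u ℤ.+ 0ℤ))) ℤ.+ (ℤ.- (a ℤ.+ b) ℤ.+ ℤ.- ((c ℤ.- 1ℤ) ℤ.* u)) ≡ u
    lem₂ = solve-∀
    Z-u0 : Z u0
    Z-u0 = subst Z (lem₂ (g0 ℤ.* u2) (g1 ℤ.* u1) g2 u0)
      (Z-+ Z-gu2 (Z-+ (Z-neg (Z-+ (Z-*ʳ u2 (Z-∣ₗ (divisible (s≤s z≤n)))) (Z-*ʳ u1 (Z-∣ₗ (divisible (s≤s (s≤s z≤n)))))))
        (Z-neg (Z-*ʳ u0 (≡[1]⇒Z g2 1ℤ (at leading 1))))))

  norm⇒admissible : ∀ {t} (α : Fin t → ℤₗ) → ¬ Z (norm (residues α)) → Adic.Admissible ℓ-prime α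
  norm⇒admissible α ¬norm ℓ∣α = ¬norm (go (residues α) λ j → Z-∣ₗ (ℓ∣α j))
    where
    go : ∀ {t} (x : Fin t → ℤ) → (∀ j → Z (x j)) → Z (norm x)
    go {zero}  x p = Z-0
    go {suc t} x p = Z-+ (Z-*ʳ (x zero) (p zero)) (go (x ∘ suc) (p ∘ suc))

  T²-distinguished : Adic.IsDistinguished ℓ-prime T² 2
  T²-distinguished = record
    { leading   = A.pointwise λ _ → refl
    ; vanishing = λ 2<i → mk≈ λ k → at (T²-vanishing 2<i) k
    ; divisible = λ i<2 → let q , eq = T²-divisible (fromℤ (+ ℓ)) i<2 in q , mk≈ λ k → at eq k
    }

  module _ (f : ℕ → ℤₗ) where

    private
      IsFactor : (g u : ℕ → ℤₗ) → Set
      IsFactor g u = Adic._≋_ ℓ-prime f (Adic._•_ ℓ-prime (fromℤ (+ (ℓ ^ 0))) (Adic._⊛_ ℓ-prime g u))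

    -- The expansions mk≈ λ k → at … k avoid a comparison of coherence proofs, which are relevant.
    factorization : ∀ g u → Adic.IsDistinguished ℓ-prime g 2 → Adic.IsUnit ℓ-prime u → IsFactor g u →
      Adic.WeierstrassFactorization ℓ-prime f 0 2
    factorization g u g-dist u-unit f≋gu = g , u , g-dist , u-unit , λ n → mk≈ λ k → at (f≋gu n) k

    T²-factorₗ : ∀ c → f 0 A.≈ A.0# → f 1 A.≈ A.0# → c A.* f 2 A.≈ A.1# → ∃[ u ] Adic.IsUnit ℓ-prime u × IsFactor T² u
    T²-factorₗ c f₀ f₁ cf₂≈1 =
      let u , u-unit , f≋T²u = T²-factor f c A.1# f₀ f₁ cf₂≈1 (A.pointwise {A.1#} {A.1#} λ _ → refl)
      in u , u-unit , λ n → mk≈ λ k → at (f≋T²u n) k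

    T²-factorization : ¬ Z (approx (f 2) 1) → f 0 A.≈ A.0# → f 1 A.≈ A.0# →
      Adic.WeierstrassFactorization ℓ-prime f 0 2
    T²-factorization ¬Z-f₂ f₀ f₁ = factorization T² (proj₁ factor) T²-distinguished (proj₁ (proj₂ factor))
      λ n → mk≈ λ k → at (proj₂ (proj₂ factor) n) k
      where
      c = proj₁ (invertₗ (f 2) ¬Z-f₂)
      factor = T²-factorₗ c f₀ f₁ (mk≈ λ k → at (proj₂ (invertₗ (f 2) ¬Z-f₂)) k)

  norm⇒invariants : ∀ {t} (α : Fin t → ℤₗ) → ¬ Z (norm (residues α)) → Adic.HasInvariants ℓ-prime α 0 1
  norm⇒invariants α ¬norm = T²-factorization (Adic.charSeries ℓ-prime α)
    (λ p → ¬norm (subst Z (lem (approx (Adic.charSeries ℓ-prime α 2) 1) (norm (residues α)))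
      (Z-+ (charSeries-2 α) (Z-neg p))))
    (charSeries-0 α) (charSeries-1 α)
    where
    lem : ∀ f n → (f ℤ.+ n) ℤ.+ ℤ.- f ≡ n
    lem = solve-∀

-- Integers in the rationals and the final identity.

fromℚᵘ-homo-+ : ∀ p q → ℚ.fromℚᵘ (p ℚᵘ.+ q) ≡ ℚ.fromℚᵘ p ℚ.+ ℚ.fromℚᵘ q
fromℚᵘ-homo-+ p q = ℚ.toℚᵘ-injective (ℚᵘ.≃-trans (ℚ.toℚᵘ-fromℚᵘ (p ℚᵘ.+ q))
  (ℚᵘ.≃-sym (ℚᵘ.≃-trans (ℚ.toℚᵘ-homo-+ (ℚ.fromℚᵘ p) (ℚ.fromℚᵘ q))
    (ℚᵘ.+-cong (ℚ.toℚᵘ-fromℚᵘ p) (ℚ.toℚᵘ-fromℚᵘ q)))))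

fromℚᵘ-homo-* : ∀ p q → ℚ.fromℚᵘ (p ℚᵘ.* q) ≡ ℚ.fromℚᵘ p ℚ.* ℚ.fromℚᵘ q
fromℚᵘ-homo-* p q = ℚ.toℚᵘ-injective (ℚᵘ.≃-trans (ℚ.toℚᵘ-fromℚᵘ (p ℚᵘ.* q))
  (ℚᵘ.≃-sym (ℚᵘ.≃-trans (ℚ.toℚᵘ-homo-* (ℚ.fromℚᵘ p) (ℚ.fromℚᵘ q))
    (ℚᵘ.*-cong (ℚ.toℚᵘ-fromℚᵘ p) (ℚ.toℚᵘ-fromℚᵘ q)))))

abstract
  ι : ℤ → ℚ.ℚ
  ι a = a ℚ./ 1

  ι-0 : ι 0ℤ ≡ ℚ.0ℚ
  ι-0 = refl

  ι-1 : ι 1ℤ ≡ 1ℚ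
  ι-1 = refl

  ι--1 : ι -1ℤ ≡ ℚ.- 1ℚ
  ι--1 = refl

  ι-+ : ∀ a b → ι (a ℤ.+ b) ≡ ι a ℚ.+ ι b
  ι-+ a b = trans (ℚ.fromℚᵘ-cong {mkℚᵘ (a ℤ.+ b) 0} {mkℚᵘ a 0 ℚᵘ.+ mkℚᵘ b 0} (*≡* (lem a b)))
    (fromℚᵘ-homo-+ (mkℚᵘ a 0) (mkℚᵘ b 0))
    where
    lem : ∀ a b → (a ℤ.+ b) ℤ.* 1ℤ ≡ (a ℤ.* 1ℤ ℤ.+ b ℤ.* 1ℤ) ℤ.* 1ℤ
    lem = solve-∀

  /-ι : ∀ a n .{{_ : NonZero n}} → a ℚ./ n ≡ ι a ℚ.* (1ℤ ℚ./ n)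
  /-ι a (suc n) = trans (ℚ.fromℚᵘ-cong {mkℚᵘ a n} {mkℚᵘ a 0 ℚᵘ.* mkℚᵘ 1ℤ n}
      (*≡* (trans (cong (λ m → a ℤ.* + m) (ℕ.*-identityˡ (suc n))) (cong (ℤ._* + suc n) (sym (ℤ.*-identityʳ a))))))
    (fromℚᵘ-homo-* (mkℚᵘ a 0) (mkℚᵘ 1ℤ n))

  ι-inverse : ∀ n .{{_ : NonZero n}} → ι (+ n) ℚ.* (1ℤ ℚ./ n) ≡ 1ℚ
  ι-inverse (suc n) = trans (sym (/-ι (+ suc n) (suc n)))
    (ℚ.fromℚᵘ-cong {mkℚᵘ (+ suc n) n} {mkℚᵘ 1ℤ 0} (*≡* (ℤ.*-comm (+ suc n) 1ℤ)))

ι-pred : ∀ n → ι (+ n ℤ.- 1ℤ) ≡ ι (+ n) ℚ.- 1ℚ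
ι-pred n = trans (ι-+ (+ n) -1ℤ) (cong (λ e → ι (+ n) ℚ.+ e) ι--1)

×-ι : ∀ n v → n ℚ×.× v ≡ ι (+ n) ℚ.* v
×-ι zero    v = trans (sym (ℚ.*-zeroˡ v)) (cong (ℚ._* v) (sym ι-0))
×-ι (suc n) v = begin
  v ℚ.+ n ℚ×.× v                   ≡⟨ cong₂ ℚ._+_ (sym (ℚ.*-identityˡ v)) (×-ι n v) ⟩
  1ℚ ℚ.* v ℚ.+ ι (+ n) ℚ.* v       ≡⟨ sym (ℚ.*-distribʳ-+ v 1ℚ (ι (+ n))) ⟩
  (1ℚ ℚ.+ ι (+ n)) ℚ.* v           ≡⟨ cong (ℚ._* v) (trans (cong (ℚ._+ ι (+ n)) (sym ι-1)) (sym (ι-+ 1ℤ (+ n)))) ⟩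
  ι (+ suc n) ℚ.* v                ∎
  where open ≡-Reasoning

0≤1/ : ∀ n .{{_ : NonZero n}} → ℚ.0ℚ ℚ.≤ 1ℤ ℚ./ n
0≤1/ n = ℚ.nonNegative⁻¹ _ {{ℚ.normalize-nonNeg 1 n}}

0≤× : ∀ n {v} → ℚ.0ℚ ℚ.≤ v → ℚ.0ℚ ℚ.≤ n ℚ×.× v
0≤× zero    0≤v = ℚ.≤-refl
0≤× (suc n) 0≤v = ℚ.+-mono-≤ 0≤v (0≤× n 0≤v)

-- Here `a` and `b` stand for the numbers of non-zeros and zeros, so a + b = ℓᵗ; `v` is the volume
-- of a ball of level one, `u` is ℓ⁻ᵗ and `w` is 1/(ℓᵗ - 1). Then 1 - F = a/(ℓᵗ - 1), and the factor
-- 1 - u = (ℓᵗ - 1)/ℓᵗ turns this into a/ℓᵗ.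
module ProbabilityIdentity (v u w F a b : ℚ.ℚ) (v≡u : v ≡ u) (F≡ : F ≡ (b ℚ.- 1ℚ) ℚ.* w)
  (Lu≡1 : (a ℚ.+ b) ℚ.* u ≡ 1ℚ) (Pw≡1 : ((a ℚ.+ b) ℚ.- 1ℚ) ℚ.* w ≡ 1ℚ) where
  open ≡-Reasoning
  open +-*-Solver

  good : a ℚ.* v ≡ (1ℚ ℚ.- u) ℚ.* (1ℚ ℚ.- F)
  good = sym (begin
    (1ℚ ℚ.- u) ℚ.* (1ℚ ℚ.- F)
      ≡⟨ cong₂ (λ e f → (e ℚ.- u) ℚ.* (1ℚ ℚ.- f)) (sym Lu≡1) F≡ ⟩
    ((a ℚ.+ b) ℚ.* u ℚ.- u) ℚ.* (1ℚ ℚ.- (b ℚ.- 1ℚ) ℚ.* w)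
      ≡⟨ solve 4 (λ a b u w → ((a :+ b) :* u :- u) :* (con 1ℚ :- (b :- con 1ℚ) :* w)
           := u :* ((a :+ b :- con 1ℚ) :- (b :- con 1ℚ) :* ((a :+ b :- con 1ℚ) :* w))) refl a b u w ⟩
    u ℚ.* ((a ℚ.+ b ℚ.- 1ℚ) ℚ.- (b ℚ.- 1ℚ) ℚ.* ((a ℚ.+ b ℚ.- 1ℚ) ℚ.* w))
      ≡⟨ cong (λ e → u ℚ.* ((a ℚ.+ b ℚ.- 1ℚ) ℚ.- (b ℚ.- 1ℚ) ℚ.* e)) Pw≡1 ⟩
    u ℚ.* ((a ℚ.+ b ℚ.- 1ℚ) ℚ.- (b ℚ.- 1ℚ) ℚ.* 1ℚ)
      ≡⟨ solve 3 (λ a b u → u :* ((a :+ b :- con 1ℚ) :- (b :- con 1ℚ) :* con 1ℚ) := a :* u) refl a b u ⟩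
    a ℚ.* u
      ≡⟨ cong (a ℚ.*_) (sym v≡u) ⟩
    a ℚ.* v ∎)

  bad : b ℚ.* v ≡ 1ℚ ℚ.- (1ℚ ℚ.- u) ℚ.* (1ℚ ℚ.- F)
  bad = begin
    b ℚ.* v                                ≡⟨ cong (b ℚ.*_) v≡u ⟩
    b ℚ.* u                                ≡⟨ solve 3 (λ a b u → b :* u := (a :+ b) :* u :- a :* u) refl a b u ⟩
    (a ℚ.+ b) ℚ.* u ℚ.- a ℚ.* u            ≡⟨ cong₂ (λ e f → e ℚ.- a ℚ.* f) Lu≡1 (sym v≡u) ⟩
    1ℚ ℚ.- a ℚ.* v                         ≡⟨ cong (λ e → 1ℚ ℚ.- e) good ⟩
    1ℚ ℚ.- (1ℚ ℚ.- u) ℚ.* (1ℚ ℚ.- F)       ∎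

-- Covers by balls of level one and the measure.

module LevelOneCover {ℓ : ℕ} (ℓ-prime : Prime ℓ) (ℓ-odd : ¬ (2 ∣ ℓ)) (t : ℕ) where
  open Characteristic ℓ-prime ℓ-odd
  open A using (ℤₗ; ball; Family; Covers; partialVolume)
  open Residues ℓ-prime ℓ-odd

  private instance
    ℓ≢0′ : NonZero ℓ
    ℓ≢0′ = ℕ.prime⇒nonZero ℓ-prime

  indicator : (ℤ → Bool) → ℤ → ℕ
  indicator p x = if p x then 1 else 0

  -- The accumulator `c` follows the recursion of `count`, so that the length of the list is a count
  -- by construction.
  points : (ℤ → Bool) → ∀ t → ℤ → List (Fin t → ℤ)
  points p zero    c = if p c then (λ ()) ∷ [] else []
  points p (suc t) c = concat (tabulate {n = ℓ} λ i →
    map (Vector._∷_ (+ toℕ i)) (points p t (c ℤ.+ + toℕ i ℤ.* + toℕ i)))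

  length-concat-tabulate : ∀ {A : Set} {n} (f : Fin n → List A) →
    length (concat (tabulate f)) ≡ sum (length ∘ f)
  length-concat-tabulate {n = zero}  f = refl
  length-concat-tabulate {n = suc n} f =
    trans (List.length-++ (f zero)) (cong (length (f zero) ℕ.+_) (length-concat-tabulate (f ∘ suc)))

  length-points : ∀ p t c → length (points p t c) ≡ count t (indicator p) c
  length-points p zero c with p c
  ... | true  = refl
  ... | false = refl
  length-points p (suc t) c = trans (length-concat-tabulate {n = ℓ} _)
    (trans (sum-cong-≗ {ℓ} λ i → trans (List.length-map (Vector._∷_ (+ toℕ i)) (points p t (c ℤ.+ + toℕ i ℤ.* + toℕ i)))
                                       (length-points p t (c ℤ.+ + toℕ i ℤ.* + toℕ i)))
           (sym (∑-def λ x → count t (indicator p) (c ℤ.+ x ℤ.* x))))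

  points-complete : ∀ p → (∀ x y → Z (x ℤ.- y) → p x ≡ p y) → ∀ {t} (x : Fin t → ℤ) c →
    p (c ℤ.+ norm x) ≡ true → Any (λ y → ∀ j → Z (x j ℤ.- y j)) (points p t c)
  points-complete p per {zero} x c eq rewrite ℤ.+-identityʳ c | eq = here λ ()
  points-complete p per {suc t} x c eq =
    Any.concat⁺ (Any.tabulate⁺ i (Any.map⁺ (Any.map extend
      (points-complete p per (x ∘ suc) (c ℤ.+ r ℤ.* r) (trans (sym (per _ _ Z-diff)) eq)))))
    where
    i = residue (x zero)
    r = + toℕ i
    N = norm (x ∘ suc)
    lem : ∀ c x r N → (x ℤ.- r) ℤ.* (x ℤ.+ r) ≡ (c ℤ.+ (x ℤ.* x ℤ.+ N)) ℤ.- (c ℤ.+ r ℤ.* r ℤ.+ N)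
    lem = solve-∀
    Z-diff : Z ((c ℤ.+ (x zero ℤ.* x zero ℤ.+ N)) ℤ.- (c ℤ.+ r ℤ.* r ℤ.+ N))
    Z-diff = subst Z (lem c (x zero) r N) (Z-*ʳ (x zero ℤ.+ r) (Z-residue (x zero)))
    extend : ∀ {y} → (∀ j → Z (x (suc j) ℤ.- y j)) → ∀ j → Z (x j ℤ.- (r Vector.∷ y) j)
    extend hyp zero    = Z-residue (x zero)
    extend hyp (suc j) = hyp j

  balls : List (Fin t → ℤ) → Family t
  balls []       i       = nothing
  balls (c ∷ cs) zero    = just (ball c 1)
  balls (c ∷ cs) (suc i) = balls cs i

  balls-cover : ∀ (α : Fin t → ℤₗ) cs → Any (λ c → ∀ j → Z (residues α j ℤ.- c j)) cs →
    ∃[ i ] Maybe.Any (α A.∈ᴮ_) (balls cs i)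
  balls-cover α (c ∷ cs) (here hyp)  = 0 , Maybe.just λ j → Z⇒≡[1] (residues α j) (c j) (hyp j)
  balls-cover α (c ∷ cs) (there hyp) = let i , i∈ = balls-cover α cs hyp in suc i , i∈

  abstract
    vol : ℚ.ℚ
    vol = Adic.ℓ^-_ ℓ-prime (1 ℕ.* t)

    vol-def : vol ≡ Adic.ℓ^-_ ℓ-prime (1 ℕ.* t)
    vol-def = refl

    0≤vol : ℚ.0ℚ ℚ.≤ vol
    0≤vol = 0≤1/ (ℓ ^ (1 ℕ.* t)) {{ℕ.m^n≢0 ℓ (1 ℕ.* t)}}

  partialVolume-balls : ∀ cs n → partialVolume (balls cs) n ℚ.≤ length cs ℚ×.× vol
  partialVolume-balls cs       zero    = 0≤× (length cs) 0≤vol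
  partialVolume-balls []       (suc n) = ℚ.+-mono-≤ {ℚ.0ℚ} {ℚ.0ℚ} ℚ.≤-refl (partialVolume-balls [] n)
  partialVolume-balls (c ∷ cs) (suc n) = ℚ.+-mono-≤ (ℚ.≤-reflexive (sym vol-def)) (partialVolume-balls cs n)

  -- One finite cover serves every ε, as its total volume is at most the stated bound.
  outerMeasure≤ : ∀ p → (∀ x y → Z (x ℤ.- y) → p x ≡ p y) → (S : Pred (Fin t → ℤₗ) 0ℓ) →
    (∀ α → S α → p (norm (residues α)) ≡ true) →
    Adic.OuterMeasure≤ ℓ-prime S (ι (+ count t (indicator p) 0ℤ) ℚ.* vol)
  outerMeasure≤ p per S S⇒p ε 0<ε = balls (points p t 0ℤ) , covers , bound
    where
    covers : Covers (balls (points p t 0ℤ)) S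
    covers α α∈S = balls-cover α (points p t 0ℤ) (points-complete p per (residues α) 0ℤ
      (trans (cong p (ℤ.+-identityˡ (norm (residues α)))) (S⇒p α α∈S)))
    bound : ∀ n → partialVolume (balls (points p t 0ℤ)) n ℚ.≤ ι (+ count t (indicator p) 0ℤ) ℚ.* vol ℚ.+ ε
    bound n = begin
      partialVolume (balls (points p t 0ℤ)) n        ≤⟨ partialVolume-balls (points p t 0ℤ) n ⟩
      length (points p t 0ℤ) ℚ×.× vol                ≡⟨ cong (ℚ×._× vol) (length-points p t 0ℤ) ⟩
      count t (indicator p) 0ℤ ℚ×.× vol              ≡⟨ ×-ι (count t (indicator p) 0ℤ) vol ⟩
      m                                              ≡⟨ ℚ.+-identityʳ m ⟨
      m ℚ.+ ℚ.0ℚ                                     ≤⟨ ℚ.+-monoʳ-≤ m (ℚ.<⇒≤ 0<ε) ⟩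
      m ℚ.+ ε                                        ∎
      where
      open ℚ.≤-Reasoning
      m = ι (+ count t (indicator p) 0ℤ) ℚ.* vol

  zero? nonzero? : ℤ → Bool
  zero? x = does (Z? x)
  nonzero? x = not (zero? x)

  zero?-periodic : ∀ x y → Z (x ℤ.- y) → zero? x ≡ zero? y
  zero?-periodic x y p with Z? x | Z? y
  ... | yes _ | yes _ = refl
  ... | no _  | no _  = refl
  ... | yes q | no ¬r = ⊥-elim (¬r (Z-resp x y p q))
  ... | no ¬q | yes r = ⊥-elim (¬q (Z-resp y x (Z-flip x y p) r))

  zero?≡true : ∀ {x} → Z x → zero? x ≡ true
  zero?≡true {x} = dec-true (Z? x)

  nonzero?≡true : ∀ {x} → ¬ Z x → nonzero? x ≡ true
  nonzero?≡true {x} ¬p = cong not (dec-false (Z? x) ¬p)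

  count-+ : ∀ φ ψ t c → count t φ c ℕ.+ count t ψ c ≡ count t (λ x → φ x ℕ.+ ψ x) c
  count-+ φ ψ zero    c = refl
  count-+ φ ψ (suc t) c = trans (sym (∑-+ (λ x → count t φ (c ℤ.+ x ℤ.* x)) (λ x → count t ψ (c ℤ.+ x ℤ.* x))))
    (∑-cong λ x → count-+ φ ψ t (c ℤ.+ x ℤ.* x))

  count-1 : ∀ φ → (∀ x → φ x ≡ 1) → ∀ t c → count t φ c ≡ ℓ ^ t
  count-1 φ φ≡1 zero    c = φ≡1 c
  count-1 φ φ≡1 (suc t) c = trans (∑-cong λ x → count-1 φ φ≡1 t (c ℤ.+ x ℤ.* x)) (∑-const (ℓ ^ t))

  zeros nonzeros : ℕ
  zeros    = count t ⟦_⟧ 0ℤ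
  nonzeros = count t (indicator nonzero?) 0ℤ

  nonzeros+zeros : nonzeros ℕ.+ zeros ≡ ℓ ^ t
  nonzeros+zeros = trans (count-+ (indicator nonzero?) ⟦_⟧ t 0ℤ) (count-1 _ one t 0ℤ)
    where
    one : ∀ x → indicator nonzero? x ℕ.+ ⟦ x ⟧ ≡ 1
    one x with Z? x
    ... | yes _ = refl
    ... | no _  = refl

  Good : Pred (Fin t → ℤₗ) 0ℓ
  Good α = Adic.Admissible ℓ-prime α × Adic.HasInvariants ℓ-prime α 0 1

  Good⇒nonzero : ∀ α → Good α → nonzero? (norm (residues α)) ≡ true
  Good⇒nonzero α (_ , inv) = nonzero?≡true (invariants⇒norm α inv)

  -- Divisibility of the norm by ℓ is decidable, so the contrapositive yields a direct conclusion
  -- without deciding `Good` itself.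
  ¬Good⇒zero : ∀ α → ¬ Good α → zero? (norm (residues α)) ≡ true
  ¬Good⇒zero α α∉Good = zero?≡true (decidable-stable (Z? (norm (residues α)))
    λ ¬p → α∉Good (norm⇒admissible α ¬p , norm⇒invariants α ¬p))

  ι-nonzeros+zeros : ι (+ nonzeros) ℚ.+ ι (+ zeros) ≡ ι (+ (ℓ ^ t))
  ι-nonzeros+zeros = trans (sym (ι-+ (+ nonzeros) (+ zeros))) (cong (λ n → ι (+ n)) nonzeros+zeros)

  module _ (2≤t : 2 ≤ t) where

    private instance
      P≢0 : NonZero (ℓ ^ t ∸ 1)
      P≢0 = ℓ^t∸1≢0 ℓ-prime 2≤t

    F : ℚ.ℚ
    F = ℚ._/_ (+ zeros ℤ.- 1ℤ) (ℓ ^ t ∸ 1) {{ℓ^t∸1≢0 ℓ-prime 2≤t}}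

    vol≡ : vol ≡ Adic.ℓ^-_ ℓ-prime t
    vol≡ = trans vol-def (cong (Adic.ℓ^-_ ℓ-prime) (ℕ.*-identityˡ t))

    F≡ : F ≡ (ι (+ zeros) ℚ.- 1ℚ) ℚ.* (1ℤ ℚ./ (ℓ ^ t ∸ 1))
    F≡ = trans (/-ι (+ zeros ℤ.- 1ℤ) (ℓ ^ t ∸ 1)) (cong (ℚ._* (1ℤ ℚ./ (ℓ ^ t ∸ 1))) (ι-pred zeros))

    Lu≡1 : (ι (+ nonzeros) ℚ.+ ι (+ zeros)) ℚ.* Adic.ℓ^-_ ℓ-prime t ≡ 1ℚ
    Lu≡1 = trans (cong (ℚ._* Adic.ℓ^-_ ℓ-prime t) ι-nonzeros+zeros) (ι-inverse (ℓ ^ t) {{ℕ.m^n≢0 ℓ t}})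

    Pw≡1 : ((ι (+ nonzeros) ℚ.+ ι (+ zeros)) ℚ.- 1ℚ) ℚ.* (1ℤ ℚ./ (ℓ ^ t ∸ 1)) ≡ 1ℚ
    Pw≡1 = trans (cong (ℚ._* (1ℤ ℚ./ (ℓ ^ t ∸ 1))) P≡) (ι-inverse (ℓ ^ t ∸ 1))
      where
      L-1≡P : + (ℓ ^ t) ℤ.- 1ℤ ≡ + (ℓ ^ t ∸ 1)
      L-1≡P = trans (ℤ.m-n≡m⊖n (ℓ ^ t) 1) (ℤ.⊖-≥ (ℕ.>-nonZero⁻¹ (ℓ ^ t) {{ℕ.m^n≢0 ℓ t}}))
      P≡ : (ι (+ nonzeros) ℚ.+ ι (+ zeros)) ℚ.- 1ℚ ≡ ι (+ (ℓ ^ t ∸ 1))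
      P≡ = trans (cong (ℚ._- 1ℚ) ι-nonzeros+zeros) (trans (sym (ι-pred (ℓ ^ t))) (cong ι L-1≡P))

    open ProbabilityIdentity vol (Adic.ℓ^-_ ℓ-prime t) (1ℤ ℚ./ (ℓ ^ t ∸ 1)) F
      (ι (+ nonzeros)) (ι (+ zeros)) vol≡ F≡ Lu≡1 Pw≡1

    hasProb : Adic.HasProb ℓ-prime t 0 1 (1ℚ ℚ.- F)
    hasProb =
        subst (Adic.OuterMeasure≤ ℓ-prime Good) good
          (outerMeasure≤ nonzero? (λ x y p → cong not (zero?-periodic x y p)) Good Good⇒nonzero)
      , subst (Adic.OuterMeasure≤ ℓ-prime (∁ Good)) bad
          (outerMeasure≤ zero? zero?-periodic (∁ Good) ¬Good⇒zero)

    hasProb-≡ : ∀ {m} → + zeros ≡ m →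
      Adic.HasProb ℓ-prime t 0 1 (1ℚ ℚ.- ℚ._/_ (m ℤ.- 1ℤ) (ℓ ^ t ∸ 1) {{ℓ^t∸1≢0 ℓ-prime 2≤t}})
    hasProb-≡ eq = subst
      (λ m → Adic.HasProb ℓ-prime t 0 1 (1ℚ ℚ.- ℚ._/_ (m ℤ.- 1ℤ) (ℓ ^ t ∸ 1) {{ℓ^t∸1≢0 ℓ-prime 2≤t}}))
      eq hasProb

theorem4p18 : (ℓ : ℕ) (ℓ-prime : Prime ℓ) → ¬ (2 ∣ ℓ) → (t : ℕ) (2≤t : 2 ≤ t) →
    (2 ∣ t → Adic.HasProb ℓ-prime t 0 1
    (1ℚ ℚ.- ℚ._/_
    (+ (ℓ ^ (t ∸ 1)) ℤ.+ -1ℤ ℤ.^ (t * (ℓ ∸ 1) / 4) ℤ.* + (ℓ ∸ 1) ℤ.* + (ℓ ^ (t / 2 ∸ 1)) ℤ.- 1ℤ)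
    (ℓ ^ t ∸ 1) {{ℓ^t∸1≢0 ℓ-prime 2≤t}}))
    ×
    (¬ (2 ∣ t) → Adic.HasProb ℓ-prime t 0 1
    (1ℚ ℚ.- ℚ._/_
    (+ (ℓ ^ (t ∸ 1)) ℤ.- 1ℤ)
    (ℓ ^ t ∸ 1) {{ℓ^t∸1≢0 ℓ-prime 2≤t}}))
theorem4p18 ℓ ℓ-prime ℓ-odd t 2≤t =
    (λ 2∣t → LevelOneCover.hasProb-≡ ℓ-prime ℓ-odd t 2≤t (zeros-even 2≤t 2∣t))
  , (λ 2∤t → LevelOneCover.hasProb-≡ ℓ-prime ℓ-odd t 2≤t (zeros-odd 2∤t))
  where
  half : ∃[ h ] ℓ ≡ suc (h ℕ.+ h)
  half = odd⇒half ℓ-odd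
  open Residues.Half ℓ-prime ℓ-odd (proj₁ half) (proj₂ half)
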